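{- Let $s$ be a positive integer and $m$ a nonnegative integer. The number of self-conjugate $(s,s+1,s+2)$-core partitions with $m$ corners is \[ \binom{\lfloor \frac{s}{2} \rfloor}{\lfloor \frac{m}{2} \rfloor,\ \lfloor \frac{m+1}{2} \rfloor,\ \lfloor \frac{s}{2} \rfloor-m}. \]
   Context: A partition is a finite (possibly empty) non-increasing sequence of positive integers, identified with its Young diagram. The number of corners of a partition is its number of distinct part sizes. The hook length of a box is the number of boxes to its right in the same row plus the number of boxes below it in the same column plus $1$. A partition is an $s$-core if no box has hook length $s$, and an $(s_1,\dots,s_q)$-core if it is an $s_i$-core for every $i$. A partition is self-conjugate if its Young diagram is invariant under reflection in the main diagonal. $\binom{n}{x,y,z}=\frac{n!}{x!\,y!\,z!}$ (with $x+y+z=n$) is the multinomial coefficient, understood to be $0$ if one of $x,y,z$ is negative. -}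

module Defs where

open import Data.Integer.Base using (ℤ; +_; -[1+_])
open import Data.List.Base using (List; []; _∷_; length; filter; drop; upTo; deduplicate)
open import Data.List.Membership.Propositional using (_∈_)
open import Data.List.Relation.Unary.All using (All)
open import Data.List.Relation.Unary.Linked using (Linked)
open import Data.List.Relation.Unary.Unique.Propositional using (Unique)
open import Data.Nat.Base using (ℕ; zero; suc; _+_; _*_; _<_; _≥_; _>_; _/_; _!; NonZero)
open import Data.Nat.Properties using (_≟_; _<?_; _!≢0; _!*_!≢0; m*n≢0)
open import Data.Product.Base using (∃; _×_)
open import Function.Bundles using (_⇔_)
open import Level using (_⊔_)
open import Relation.Binary.PropositionalEquality.Core using (_≡_; _≢_)
open import Relation.Unary using (Pred)

IsPartition : List ℕ → Set
IsPartition p = Linked _≥_ p × All (_> 0) p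

-- The length of row i, rows being numbered from 0; it is 0 past the last row.
part : List ℕ → ℕ → ℕ
part []      i       = 0
part (x ∷ p) zero    = x
part (x ∷ p) (suc i) = part p i

-- Membership of the box in row i and column j (both numbered from 0) in the
-- Young diagram of p.
Box : List ℕ → ℕ → ℕ → Set
Box p i j = j < part p i

corners : List ℕ → ℕ
corners p = length (deduplicate _≟_ p)

-- Row i consists of the columns in upTo (part p i); the arm counts those
-- strictly to the right of j.
arm : List ℕ → ℕ → ℕ → ℕ
arm p i j = length (filter (j <?_) (upTo (part p i)))

-- The rows strictly below row i are listed by drop (suc i) p; a row of length
-- x has a box in column j exactly when j < x.
leg : List ℕ → ℕ → ℕ → ℕ
leg p i j = length (filter (j <?_) (drop (suc i) p))

hook : List ℕ → ℕ → ℕ → ℕ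
hook p i j = arm p i j + leg p i j + 1

IsCore : ℕ → List ℕ → Set
IsCore s p = ∀ i j → Box p i j → hook p i j ≢ s

AreCores : List ℕ → List ℕ → Set
AreCores ss p = All (λ s → IsCore s p) ss

SelfConjugate : List ℕ → Set
SelfConjugate p = ∀ i j → Box p i j ⇔ Box p j i

-- Exactly n elements of A satisfy P: some repetition-free list of length n
-- contains precisely those elements.
HasCardinality : ∀ {a ℓ} {A : Set a} → Pred A ℓ → ℕ → Set (a ⊔ ℓ)
HasCardinality P n =
  ∃ λ xs → Unique xs × (∀ x → (x ∈ xs) ⇔ P x) × length xs ≡ n

-- n! / (x! y! z!), or 0 when one of x, y, z is negative.  Only meaningful when
-- x + y + z = n, in which case the division is exact.
multinomial : ℕ → ℤ → ℤ → ℤ → ℕ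
multinomial n (+ x) (+ y) (+ z) = n ! / (x ! * y ! * z !)
  where
  instance
    denominator≢0 : NonZero (x ! * y ! * z !)
    denominator≢0 = m*n≢0 (x ! * y !) (z !) {{x !* y !≢0}} {{z !≢0}}
multinomial n -[1+ _ ] _        _        = 0
multinomial n (+ _)    -[1+ _ ] _        = 0
multinomial n (+ _)    (+ _)    -[1+ _ ] = 0

{-# OPTIONS --safe #-}
-- Call x = part p i − i − 1 a bead of p. A self-conjugate p has exactly one bead
-- among x and −1 − x, and it is an s-core iff its set of beads is closed under
-- subtraction of s. Closure under s + 1 encodes the beads by a level function f,
-- x + q (s + 1) being a bead iff q < f x, with f (x + s + 1) = f x − 1; closure
-- under s and s + 2 says that f has steps in {−1, 0, 1}, and self-conjugacy that
-- f (s − x) = − f x. Hence f is determined by the word of its k = ⌊s/2⌋ steps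
-- between f k = 0 and f 0 ∈ {0, 1}, and every such word occurs. A corner of p is
-- an ascent of f from level 0 to level 1, so corners correspond to ascents in one
-- period, of which there are as many as nonzero letters in the word.
module Submission where

open import Defs
open import Data.Fin.Base using (Fin; zero; suc)
import Data.Fin.Properties as Fin
open import Data.Integer.Base using (ℤ; +_; -[1+_]; 0ℤ; 1ℤ; -1ℤ; +≤+; -≤+; _-_)
import Data.Integer.Base as ℤ
import Data.Integer.DivMod as ℤ
import Data.Integer.Properties as ℤ
import Data.Integer.Solver as ℤ-Solver
open import Data.List.Base using (List; []; _∷_; _++_; length; filter; drop; upTo; deduplicate; lookup; map)
open import Data.List.Membership.Propositional using (_∈_)
open import Data.List.Membership.Propositional.Properties
  using (∈-++⁺ˡ; ∈-++⁺ʳ; ∈-++⁻; ∈-map⁺; ∈-map⁻; ∈-lookup; ∈-filter⁺; ∈-filter⁻; ∈-upTo⁺; ∈-upTo⁻;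
      ∈-deduplicate⁺; ∈-deduplicate⁻)
open import Data.List.Properties using
    (filter-accept; filter-reject; filter-++; length-++; length-map; upTo-∷ʳ)
open import Data.List.Relation.Unary.All using (All; []; _∷_)
import Data.List.Relation.Unary.All as All
open import Data.List.Relation.Unary.AllPairs using ([]; _∷_)
open import Data.List.Relation.Unary.Any using (here; there; index)
open import Data.List.Relation.Unary.Any.Properties using (lookup-index)
open import Data.List.Relation.Unary.Linked using (Linked; []; [-]; _∷_)
import Data.List.Relation.Unary.Linked as Linked
import Data.List.Relation.Unary.Unique.DecPropositional.Properties as DecUnique
open import Data.List.Relation.Unary.Unique.Propositional using (Unique)
import Data.List.Relation.Unary.Unique.Propositional.Properties as Unique
open import Data.Nat.Base
open import Data.Nat.DivMod hiding (_/_; _%_)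
open import Data.Nat.Divisibility.Core using (divides)
open import Data.Nat.Properties
open import Data.Nat.Tactic.RingSolver using (solve-∀)
open import Data.Product.Base using (∃; ∃₂; _×_; _,_; proj₁; proj₂)
open import Data.Sum.Base using (_⊎_; inj₁; inj₂; [_,_]′; swap)
open import Data.Vec.Base using (Vec; []; _∷_)
import Data.Vec.Properties as Vec
open import Function.Base using (_∘_)
open import Function.Bundles using (_⇔_; mk⇔; Equivalence)
open import Relation.Binary.Definitions using (tri<; tri≈; tri>)
open import Relation.Binary.PropositionalEquality
  using (_≡_; _≢_; refl; sym; trans; cong; cong₂; subst; subst₂; module ≡-Reasoning)
open import Relation.Nullary using (¬_; Dec; yes; no; contradiction)
open import Relation.Unary using (Decidable)

open Equivalence using (to; from)
open ℤ-Solver.+-*-Solver using (solve; _:=_; _:+_; _:*_; _:-_; :-_; con)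

-- The modulus `s + 1` is the useful one because `s` and `s + 2` are -1 and 1 modulo it, so the
-- other two closures compare neighbouring residues. From s to s + 1 the level goes from -f 0 to f 0
-- - 1, a step of 2 f 0 - 1. This is why f 0 can only be 0 or 1, and this step is an ascent exactly
-- when f 0 = 1. Below s, the symmetry carries the step at x to the step at s - 1 - x and keeps its
-- sign, so the ascents there are twice those of the first half, that is, twice the falls of the
-- word, which is read from k down to 0. As rises - falls = f 0, the total is 2 falls + f 0 = rises
-- + falls. So m and rises - falls ∈ {0, 1} together fix both counts, and this produces the two
-- floors in the multinomial coefficient. For existence, a diagram is built from the prescribed
-- nonnegative beads only; reflection supplies the negative ones.

part-step : ∀ {p} → Linked _≥_ p → ∀ i → part p (suc i) ≤ part p i
part-step []       i       = z≤n
part-step [-]      i       = z≤n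
part-step (x≥y ∷ l) zero    = x≥y
part-step (x≥y ∷ l) (suc i) = part-step l i

part-antitone : ∀ {p} → Linked _≥_ p → ∀ {i j} → i ≤ j → part p j ≤ part p i
part-antitone {p} l i≤j = go (≤⇒≤′ i≤j)
  where
  go : ∀ {i j} → i ≤′ j → part p j ≤ part p i
  go ≤′-refl         = ≤-refl
  go (≤′-step i≤′j) = ≤-trans (part-step l _) (go i≤′j)

part-beyond : ∀ p {i} → length p ≤ i → part p i ≡ 0
part-beyond []      _         = refl
part-beyond (x ∷ p) (s≤s p≤i) = part-beyond p p≤i

part-ext : ∀ {p q} → IsPartition p → IsPartition q → (∀ i → part p i ≡ part q i) → p ≡ q
part-ext {[]}    {[]}    _ _ _ = refl
part-ext {[]}    {y ∷ q} _ (_ , y>0 ∷ _) eq = contradiction (subst (_> 0) (sym (eq 0)) y>0) n≮0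
part-ext {x ∷ p} {[]}    (_ , x>0 ∷ _) _ eq = contradiction (subst (_> 0) (eq 0) x>0) n≮0
part-ext {x ∷ p} {y ∷ q} (lp , _ ∷ ap) (lq , _ ∷ aq) eq =
  cong₂ _∷_ (eq 0) (part-ext (Linked.tail lp , ap) (Linked.tail lq , aq) (eq ∘ suc))

part∈ : ∀ p i → part p i > 0 → part p i ∈ p
part∈ (x ∷ p) zero    _   = here refl
part∈ (x ∷ p) (suc i) v>0 = there (part∈ p i v>0)

∈⇒part : ∀ {p v} → v ∈ p → ∃ λ i → part p i ≡ v
∈⇒part (here refl) = 0 , refl
∈⇒part (there v∈p) with ∈⇒part v∈p
... | i , eq = suc i , eq

-- The rows of length `v` form a block that ends before row `length p`, so walking down from any of
-- them stops. The last row of the block carries the corner belonging to the part size `v`.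
∈⇒last-part : ∀ {p v} → IsPartition p → v ∈ p → ∃ λ i → part p i ≡ v × part p (suc i) < v
∈⇒last-part {p} {v} (l , pos) v∈p = search (length p) (proj₁ first) (m≤m+n _ _) (proj₂ first)
  where
  first = ∈⇒part v∈p
  positive : ∀ {q} → All (_> 0) q → v ∈ q → v > 0
  positive (v>0 ∷ _) (here refl) = v>0
  positive (_ ∷ q>0) (there v∈q) = positive q>0 v∈q
  search : ∀ n i → length p ≤ n + i → part p i ≡ v → ∃ λ i → part p i ≡ v × part p (suc i) < v
  search zero    i p≤i eq = contradiction
      (subst (_> 0) (trans (sym eq) (part-beyond p p≤i)) (positive pos v∈p)) n≮0
  search (suc n) i p≤i eq with part p (suc i) ≟ v
  ... | yes eq′ = search n (suc i) (subst (length p ≤_) (sym (+-suc n i)) p≤i) eq′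
  ... | no neq  = i , eq , ≤∧≢⇒< (subst (part p (suc i) ≤_) eq (part-step l i)) neq

-- Cutting the list off at a zero keeps every entry positive, so in `fromParts` the first argument
-- is only a bound on the number of rows.
prepend : ℕ → List ℕ → List ℕ
prepend zero    p = []
prepend (suc n) p = suc n ∷ p

fromParts : ℕ → (ℕ → ℕ) → List ℕ
fromParts zero    g = []
fromParts (suc n) g = prepend (g 0) (fromParts n (g ∘ suc))

Antitone : (ℕ → ℕ) → Set
Antitone g = ∀ i → g (suc i) ≤ g i

antitone-zero : ∀ {g} → Antitone g → g 0 ≡ 0 → ∀ i → g i ≡ 0
antitone-zero anti g0 zero    = g0
antitone-zero {g} anti g0 (suc i) = n≤0⇒n≡0 (subst (g (suc i) ≤_) (antitone-zero anti g0 i) (anti i))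

part-fromParts : ∀ n {g} → Antitone g → g n ≡ 0 → ∀ i → part (fromParts n g) i ≡ g i
part-fromParts zero        anti gn i = sym (antitone-zero anti gn i)
part-fromParts (suc n) {g} anti gn i with g 0 in eq
part-fromParts (suc n) anti gn i       | zero  = sym (antitone-zero anti eq i)
part-fromParts (suc n) anti gn zero    | suc m = sym eq
part-fromParts (suc n) anti gn (suc i) | suc m = part-fromParts n (anti ∘ suc) gn i

prepend-partition : ∀ {n p} → part p 0 ≤ n → IsPartition p → IsPartition (prepend n p)
prepend-partition {zero}          _   _           = [] , []
prepend-partition {suc n} {[]}    _   _           = [-] , z<s ∷ []
prepend-partition {suc n} {x ∷ p} x≤n (l , pos)   = x≤n ∷ l , z<s ∷ pos

fromParts-partition : ∀ n {g} → Antitone g → g n ≡ 0 → IsPartition (fromParts n g)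
fromParts-partition zero    anti gn = [] , []
fromParts-partition (suc n) {g} anti gn = prepend-partition
  (subst (_≤ g 0) (sym (part-fromParts n (anti ∘ suc) gn 0)) (anti 0))
  (fromParts-partition n (anti ∘ suc) gn)

-- Hook lengths in a self-conjugate partition

-- In a non-increasing list the entries above `j` form an initial segment, so counting them gives
-- the length of column `j`.
length-filter-> : ∀ {p} → Linked _≥_ p → ∀ j i → i < length (filter (j <?_) p) ⇔ j < part p i
length-filter-> {[]}    l j i = mk⇔ (λ ()) (λ ())
length-filter-> {x ∷ p} l j i with j <? x
length-filter-> {x ∷ p} l j zero    | yes j<x rewrite filter-accept (j <?_) {xs = p} j<x =
  mk⇔ (λ _ → j<x) (λ _ → z<s)
length-filter-> {x ∷ p} l j (suc i) | yes j<x rewrite filter-accept (j <?_) {xs = p} j<x =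
  mk⇔ (to rec ∘ s<s⁻¹) (s<s ∘ from rec)
  where rec = length-filter-> (Linked.tail l) j i
length-filter-> {x ∷ p} l j i | no j≮x rewrite filter-reject (j <?_) {xs = p} j≮x =
  mk⇔ (λ h → contradiction (<-≤-trans (to (length-filter-> (Linked.tail l) j i) h)
      (part-antitone l {0} {suc i} z≤n)) j≮x)
      (λ h → contradiction (<-≤-trans h (part-antitone l {0} {i} z≤n)) j≮x)

part-drop : ∀ n p i → part (drop n p) i ≡ part p (n + i)
part-drop zero    p       i = refl
part-drop (suc n) []      i = refl
part-drop (suc n) (x ∷ p) i = part-drop n p i

drop-linked : ∀ n {p} → Linked _≥_ p → Linked _≥_ (drop n p)
drop-linked zero    l = l
drop-linked (suc n) {[]} l = []
drop-linked (suc n) {x ∷ p} l = drop-linked n (Linked.tail l)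

<-cong⇒≡ : ∀ {m n} → (∀ i → i < m ⇔ i < n) → m ≡ n
<-cong⇒≡ h = ≤-antisym (≮⇒≥ λ n<m → <-irrefl refl (to (h _) n<m))
                        (≮⇒≥ λ m<n → <-irrefl refl (from (h _) m<n))

length-filter-upTo-suc : ∀ {P : ℕ → Set} (P? : Decidable P) n →
  length (filter P? (upTo (suc n))) ≡ length (filter P? (upTo n)) + length (filter P? (n ∷ []))
length-filter-upTo-suc P? n = begin
  length (filter P? (upTo (suc n)))
    ≡⟨ cong (λ xs → length (filter P? xs)) (upTo-∷ʳ n) ⟨
  length (filter P? (upTo n ++ n ∷ []))
    ≡⟨ cong length (filter-++ P? (upTo n) (n ∷ [])) ⟩
  length (filter P? (upTo n) ++ filter P? (n ∷ []))
    ≡⟨ length-++ (filter P? (upTo n)) ⟩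
  length (filter P? (upTo n)) + length (filter P? (n ∷ [])) ∎
  where open ≡-Reasoning

arm-≡ : ∀ p i j → arm p i j ≡ part p i ∸ suc j
arm-≡ p i j = count (part p i)
  where
  count : ∀ n → length (filter (j <?_) (upTo n)) ≡ n ∸ suc j
  count zero = refl
  count (suc n) with j <? n
  ... | yes j<n = trans (length-filter-upTo-suc (j <?_) n) (trans
      (cong₂ _+_ (count n) (cong length (filter-accept (j <?_) {xs = []} j<n)))
      (trans (+-comm _ 1) (sym (+-∸-assoc 1 j<n))))
  ... | no j≮n  = trans (length-filter-upTo-suc (j <?_) n) (trans
      (cong₂ _+_ (count n) (cong length (filter-reject (j <?_) {xs = []} j≮n)))
      (trans (+-identityʳ _)
      (trans (m≤n⇒m∸n≡0 (m≤n⇒m≤1+n (≮⇒≥ j≮n))) (sym (m≤n⇒m∸n≡0 (≮⇒≥ j≮n))))))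

-- By symmetry column `j` has as many boxes as row `j`. The top `suc i` of them lie in rows 0 to
-- `i`, and the others make up the leg.
leg-≡ : ∀ {p} → IsPartition p → SelfConjugate p → ∀ {i j} → Box p i j → suc i + leg p i j ≡ part p j
leg-≡ {p} (l , _) sc {i} {j} box with m≤n⇒∃[o]m+o≡n (to (sc i j) box)
... | c , eq = trans (cong (λ t → suc i + t) (<-cong⇒≡ λ n → mk⇔
  (λ h → +-cancelˡ-< (suc i) n c (subst (suc i + n <_) (sym eq)
           (to (sc _ _) (subst (j <_) (part-drop (suc i) p n) (to (rows n) h)))))
  (λ h → from (rows n) (subst (j <_) (sym (part-drop (suc i) p n))
           (from (sc _ _) (subst (suc i + n <_) eq (+-monoʳ-< (suc i) h))))))) eq
  where rows = length-filter-> (drop-linked (suc i) l) j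

-- In terms of the beads x and y of rows `i` and `j`, this says that the hook length is x + y + 1.
box-symmetric-hook : ∀ {p} → IsPartition p → SelfConjugate p → ∀ {i j} → Box p i j →
  part p i + part p j ≡ suc (hook p i j + i + j)
box-symmetric-hook {p} ip sc {i} {j} box = begin
  part p i + part p j
    ≡⟨ cong₂ _+_ (m+[n∸m]≡n box) (leg-≡ ip sc box) ⟨
  suc j + (part p i ∸ suc j) + (suc i + leg p i j)
    ≡⟨ cong (λ a → suc j + a + (suc i + leg p i j)) (arm-≡ p i j) ⟨
  suc j + arm p i j + (suc i + leg p i j)
    ≡⟨ regroup i j (arm p i j) (leg p i j) ⟩
  suc (hook p i j + i + j) ∎
  where
  open ≡-Reasoning
  regroup : ∀ i j a b → suc j + a + (suc i + b) ≡ suc (a + b + 1 + i + j)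
  regroup = solve-∀

PartSumsAvoid : ℕ → List ℕ → Set
PartSumsAvoid s p = ∀ i j → part p i + part p j ≢ suc (s + i + j)

-- Outside the diagram `part p i ≤ j` and, by symmetry, `part p j ≤ i`, so the sum is too small to
-- reach the forbidden value. Hence the condition can range over all pairs instead of boxes.
core⇔avoid : ∀ {p s} → IsPartition p → SelfConjugate p → IsCore s p ⇔ PartSumsAvoid s p
core⇔avoid {p} {s} ip sc = mk⇔ forth back
  where
  back : PartSumsAvoid s p → IsCore s p
  back avoid i j box h = avoid i j (subst (λ t → part p i + part p j ≡ suc (t + i + j)) h
      (box-symmetric-hook ip sc box))
  forth : IsCore s p → PartSumsAvoid s p
  forth core i j eq with j <? part p i
  ... | yes box = core i j box (+-cancelʳ-≡ i _ _ (+-cancelʳ-≡ j _ _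
          (suc-injective (trans (sym (box-symmetric-hook ip sc box)) eq))))
  ... | no ¬box = <-irrefl eq (begin-strict
      part p i + part p j ≤⟨ +-mono-≤ (≮⇒≥ ¬box) (≮⇒≥ (¬box ∘ from (sc i j))) ⟩
      j + i               ≡⟨ +-comm j i ⟩
      i + j               <⟨ s≤s (+-monoˡ-≤ j (m≤n+m i s)) ⟩
      suc (s + i + j)     ∎)
    where open ≤-Reasoning

-- Linear arithmetic by certificates: the equation says that f − e is the sum of
-- the differences of the two sides of the hypotheses, all subtractions having
-- been moved across, so that it is an identity for the ring solver.
≤-by₁ : ∀ {a b e f} → a ℤ.≤ b → f ℤ.+ a ≡ e ℤ.+ b → e ℤ.≤ f
≤-by₁ {a} {b} {e} {f} a≤b eq = ℤ.0≤i-j⇒j≤i (subst (0ℤ ℤ.≤_) same (ℤ.i≤j⇒0≤j-i a≤b))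
  where
  open ≡-Reasoning
  same : b ℤ.- a ≡ f ℤ.- e
  same = begin
    b ℤ.- a                   ≡⟨ solve 3 (λ a b e → b :- a := e :+ b :- a :- e) refl a b e ⟩
    e ℤ.+ b ℤ.- a ℤ.- e       ≡⟨ cong (λ t → t ℤ.- a ℤ.- e) eq ⟨
    f ℤ.+ a ℤ.- a ℤ.- e       ≡⟨ solve 3 (λ a e f → f :+ a :- a :- e := f :- e) refl a e f ⟩
    f ℤ.- e                   ∎

≤-by₂ : ∀ {a b c d e f} → a ℤ.≤ b → c ℤ.≤ d → f ℤ.+ (a ℤ.+ c) ≡ e ℤ.+ (b ℤ.+ d) → e ℤ.≤ f
≤-by₂ a≤b c≤d = ≤-by₁ (ℤ.+-mono-≤ a≤b c≤d)

≤-by₃ : ∀ {a b c d e f g h} → a ℤ.≤ b → c ℤ.≤ d → g ℤ.≤ h →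
        f ℤ.+ (a ℤ.+ c ℤ.+ g) ≡ e ℤ.+ (b ℤ.+ d ℤ.+ h) → e ℤ.≤ f
≤-by₃ a≤b c≤d = ≤-by₂ (ℤ.+-mono-≤ a≤b c≤d)

≡-by : ∀ {a b e f} → a ≡ b → f ℤ.+ a ≡ e ℤ.+ b → e ≡ f
≡-by {a} {e = e} {f} refl eq = ℤ.≤-antisym (≤-by₁ (ℤ.≤-refl {a}) eq) (≤-by₁ (ℤ.≤-refl {a}) (sym eq))

1≰0 : ¬ 1ℤ ℤ.≤ 0ℤ
1≰0 (+≤+ ())

-- Beads and their symmetry

-- In a self-conjugate partition, exactly one of y and −1−y has the form
-- part p i − i − 1.
record Bead (p : List ℕ) (x : ℤ) : Set where
  constructor bead
  field
    row   : ℕ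
    row-≡ : x ℤ.+ + suc row ≡ + part p row

module _ {p} (l : Linked _≥_ p) where

  bead-antitone : ∀ {x y} ((bead i _) : Bead p x) ((bead j _) : Bead p y) → i ≤ j → y ℤ.+ + j ℤ.≤ x ℤ.+ + i
  bead-antitone {x} {y} (bead i x≡) (bead j y≡) i≤j =
    ≤-by₁ (subst₂ ℤ._≤_ (sym y≡) (sym x≡) (+≤+ (part-antitone l i≤j)))
      (solve 4 (λ x y i j → x :+ i :+ (y :+ (con 1ℤ :+ j)) := y :+ j :+ (x :+ (con 1ℤ :+ i))) refl x y
          (+ i) (+ j))

  bead-decreasing : ∀ {x y} ((bead i _) : Bead p x) ((bead j _) : Bead p y) → i < j → y ℤ.< x
  bead-decreasing {x} {y} bx@(bead i _) by@(bead j _) i<j = ℤ.suc[i]≤j⇒i<j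
    (≤-by₂ (bead-antitone bx by (<⇒≤ i<j)) (+≤+ i<j)
      (solve 4 (λ x y i j → x :+ (y :+ j :+ (con 1ℤ :+ i)) := con 1ℤ :+ y :+ (x :+ i :+ j)) refl x y
          (+ i) (+ j)))

  bead-index : ∀ {x} ((bead i _) : Bead p x) ((bead j _) : Bead p x) → i ≡ j
  bead-index b@(bead i _) c@(bead j _) =
    ≤-antisym (≮⇒≥ λ j<i → ℤ.<-irrefl refl (bead-decreasing c b j<i))
        (≮⇒≥ λ i<j → ℤ.<-irrefl refl (bead-decreasing b c i<j))

  bead-bounded : ∀ {x} → Bead p x → x ℤ.< + part p 0
  bead-bounded {x} (bead i x≡) = ℤ.suc[i]≤j⇒i<j
      (≤-by₂ (ℤ.≤-reflexive x≡) (+≤+ (≤-trans (part-antitone l z≤n) (m≤m+n (part p 0) i)))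
      (solve 4 (λ x i a b → a :+ (x :+ (con 1ℤ :+ i) :+ b) := con 1ℤ :+ x :+ (b :+ (a :+ i))) refl x
          (+ i) (+ part p 0) (+ part p i)))

-- Beads decrease strictly with the row. At the first row `i` where the partitions differ, the bead
-- of the longer row would have to be a bead of the other partition.
bead-ext : ∀ {p q} → IsPartition p → IsPartition q → (∀ x → Bead p x ⇔ Bead q x) → p ≡ q
bead-ext {p} {q} ip iq same = part-ext ip iq (λ i → agree (suc i) i ≤-refl)
  where
  not-less : ∀ {p q} → IsPartition p → IsPartition q → (∀ x → Bead q x → Bead p x) → ∀ i →
    (∀ j → j < i → part p j ≡ part q j) → ¬ (part p i < part q i)
  not-less {p} {q} (lp , _) (lq , _) q⊆p i eq p<q = absurd (q⊆p x (bead i x≡))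
    where
    x : ℤ
    x = + part q i ℤ.- + suc i
    x≡ : x ℤ.+ + suc i ≡ + part q i
    x≡ = solve 2 (λ a b → a :- b :+ b := a) refl (+ part q i) (+ suc i)
    bp : Bead p (+ part p i ℤ.- + suc i)
    bp = bead i (solve 2 (λ a b → a :- b :+ b := a) refl (+ part p i) (+ suc i))
    absurd : ¬ Bead p x
    absurd b@(bead j eqj) with j <? i
    -- Above row `i` the partitions agree, so `x` would be the bead of two rows of `q`.
    ... | yes j<i = <-irrefl (bead-index lq {x} (bead j (trans eqj (cong +_ (eq j j<i)))) (bead i x≡)) j<i
    -- From row `i` on, the beads of `p` are at most that of its row `i`, which is smaller than `x`.
    ... | no j≮i  = 1≰0 (≤-by₃ (bead-antitone lp bp b (≮⇒≥ j≮i)) (+≤+ (≮⇒≥ j≮i)) (+≤+ p<q)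
       (solve 4 (λ i j a b → con 0ℤ :+ (b :- (con 1ℤ :+ i) :+ j :+ i :+ (con 1ℤ :+ a)) := con 1ℤ :+
           (a :- (con 1ℤ :+ i) :+ i :+ j :+ b)) refl (+ i) (+ j) (+ part p i) (+ part q i)))
  agree : ∀ n i → i < n → part p i ≡ part q i
  agree (suc n) i i<n = ≤-antisym
    (≮⇒≥ (not-less iq ip (to ∘ same) i (λ j j<i → sym (agree n j (<-≤-trans j<i (s≤s⁻¹ i<n))))))
    (≮⇒≥ (not-less ip iq (from ∘ same) i (λ j j<i → agree n j (<-≤-trans j<i (s≤s⁻¹ i<n)))))

-- Defined on constructors so that it is an involution by computation; negative cases below then
-- reduce to nonnegative ones by exchanging the two alternatives.
mirror : ℤ → ℤ
mirror (+ y)    = -[1+ y ]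
mirror -[1+ y ] = + y

mirror-≡ : ∀ x → mirror x ≡ -1ℤ ℤ.- x
mirror-≡ (+ zero)  = refl
mirror-≡ (+ suc y) = refl
mirror-≡ -[1+ y ]  = refl

module _ {p} (ip : IsPartition p) (sc : SelfConjugate p) where

  private
    l : Linked _≥_ p
    l = proj₁ ip

  -- Climb the diagonal of boxes (i, y + i) from outside the diagram to the first box inside. The
  -- boundary crosses the diagonal just past it: either row `i` ends there, which makes y a bead, or
  -- column y + i + 1 has exactly i + 1 boxes, which by symmetry is the length of the row with that
  -- number and makes -1 - y a bead.
  boundary-row : ∀ y i → part p i ≤ y + i →
    (∃ λ i → y + suc i ≡ part p i) ⊎ (∃ λ j → part p j + y ≡ j)
  boundary-row y zero    p≤ = inj₂ (y , cong (_+ y) (n≤0⇒n≡0 (≮⇒≥ λ 0<p →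
    <⇒≱ (from (sc 0 y) 0<p) (subst (part p 0 ≤_) (+-identityʳ y) p≤))))
  boundary-row y (suc i) p≤ with part p i ≤? y + i
  ... | yes p≤′ = boundary-row y i p≤′
  ... | no p≰ with y + suc i ≟ part p i
  ...   | yes eq = inj₁ (i , eq)
  ...   | no neq = inj₂ (y + suc i , trans (cong (_+ y) (≤-antisym
        (≮⇒≥ λ i<p → <⇒≱ (from (sc (suc i) (y + suc i)) i<p) p≤)
        (to (sc i (y + suc i)) (≤∧≢⇒< (subst (_≤ part p i) (sym (+-suc y i)) (≰⇒> p≰)) neq))))
        (+-comm (suc i) y))

  -- Row `i` ends with the box (i, y + i). Reflecting this box and the missing one to its right
  -- shows that row y + i is longer than `i` and row y + i + 1 is not. Row `j` compares with one of
  -- the two, and its length cannot then be j - y.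
  boundary-exclusive : ∀ y i j → y + suc i ≡ part p i → ¬ (part p j + y ≡ j)
  boundary-exclusive y i j pi pj with j ≤? y + i
  ... | yes j≤ = <-irrefl (sym pj) (begin-strict
    j                      ≤⟨ j≤ ⟩
    y + i                  ≡⟨ +-comm y i ⟩
    i + y                  <⟨ +-monoˡ-< y
        (to (sc i (y + i)) (subst (y + i <_) pi (+-monoʳ-< y (n<1+n i)))) ⟩
    part p (y + i) + y     ≤⟨ +-monoˡ-≤ y (part-antitone l j≤) ⟩
    part p j + y           ∎)
    where open ≤-Reasoning
  ... | no j≰ = <-irrefl pj (begin-strict
    part p j + y               ≤⟨ +-monoˡ-≤ y (part-antitone l (subst (_≤ j) (sym (+-suc y i)) (≰⇒> j≰))) ⟩
    part p (y + suc i) + y     ≤⟨ +-monoˡ-≤ y (≮⇒≥ λ i<p → <-irrefl pi (from (sc i (y + suc i)) i<p)) ⟩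
    i + y                      ≡⟨ +-comm i y ⟩
    y + i                      <⟨ ≰⇒> j≰ ⟩
    j                          ∎)
    where open ≤-Reasoning

  private
    negative : ∀ {y j} → part p j + y ≡ j → Bead p -[1+ y ]
    negative {y} {j} eq = bead j (≡-by {+ j} {+ (part p j + y)} (cong +_ (sym eq))
      (solve 3 (λ y j a → a :+ j := :- (con 1ℤ :+ y) :+ (con 1ℤ :+ j) :+ (a :+ y)) refl (+ y) (+ j)
          (+ part p j)))

  bead-or-mirror : ∀ x → Bead p x ⊎ Bead p (mirror x)
  bead-or-mirror (+ y) with boundary-row y (length p)
      (subst (_≤ y + length p) (sym (part-beyond p ≤-refl)) z≤n)
  ... | inj₁ (i , eq) = inj₁ (bead i (cong +_ eq))
  ... | inj₂ (j , eq) = inj₂ (negative eq)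
  bead-or-mirror -[1+ y ] = swap (bead-or-mirror (+ y))

  bead-exclusive : ∀ x → Bead p x → ¬ Bead p (mirror x)
  bead-exclusive (+ y) (bead i x≡) (bead j y≡) = boundary-exclusive y i j (ℤ.+-injective x≡)
    (ℤ.+-injective (≡-by {f = + j} (sym y≡)
      (solve 3 (λ y j a → j :+ a := a :+ y :+ (:- (con 1ℤ :+ y) :+ (con 1ℤ :+ j))) refl (+ y) (+ j)
          (+ part p j))))
  bead-exclusive -[1+ y ] b c = bead-exclusive (+ y) c b

  bead-mirror : ∀ x → Bead p (mirror x) ⇔ (¬ Bead p x)
  bead-mirror x = mk⇔ (λ m b → bead-exclusive x b m)
      (λ ¬b → [ (λ b → contradiction b ¬b) , (λ m → m) ]′ (bead-or-mirror x))

  bead? : ∀ x → Dec (Bead p x)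
  bead? x with bead-or-mirror x
  ... | inj₁ b = yes b
  ... | inj₂ m = no (to (bead-mirror x) m)

  -- The mirror image of a non-bead this low would exceed every bead.
  bead-low : ∀ {x} → x ℤ.< ℤ.- + part p 0 → Bead p x
  bead-low {x} x<-p with bead? x
  ... | yes b = b
  ... | no ¬b = contradiction (≤-by₂ (ℤ.i<j⇒suc[i]≤j
      (bead-bounded l (subst (Bead p) (mirror-≡ x) (from (bead-mirror x) ¬b)))) (ℤ.i<j⇒suc[i]≤j x<-p)
      (solve 2 (λ x a → con 0ℤ :+ ((con 1ℤ :+ (con -1ℤ :- x)) :+ (con 1ℤ :+ x)) := con 1ℤ :+
          (a :+ :- a)) refl x (+ part p 0))) 1≰0

  -- A hook of length `s` amounts to beads x and y with x + y + 1 = s. Then x - s is the mirror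
  -- image of y, so it is a non-bead, and conversely.
  core⇔bead : ∀ {s} → IsCore s p ⇔ (∀ x → Bead p x → Bead p (x ℤ.- + s))
  core⇔bead {s} = mk⇔ forth back
    where
    forth : IsCore s p → ∀ x → Bead p x → Bead p (x ℤ.- + s)
    forth core x b@(bead i x≡) with bead-or-mirror (x ℤ.- + s)
    ... | inj₁ b′ = b′
    ... | inj₂ m with subst (Bead p) (mirror-≡ (x ℤ.- + s)) m
    ...   | bead j y≡ = contradiction (ℤ.+-injective
              (trans (cong₂ ℤ._+_ (sym x≡) (sym y≡))
              (solve 4 (λ x s i j → (x :+ (con 1ℤ :+ i)) :+ (con -1ℤ :- (x :- s) :+ (con 1ℤ :+ j)) :=
                  con 1ℤ :+ (s :+ i :+ j)) refl x (+ s) (+ i) (+ j))))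
              (to (core⇔avoid ip sc) core i j)
    back : (∀ x → Bead p x → Bead p (x ℤ.- + s)) → IsCore s p
    back closed = from (core⇔avoid ip sc) λ i j eq →
      let x = + part p i ℤ.- + suc i
          y = + part p j ℤ.- + suc j
          bx = bead {x = x} i (solve 2 (λ a b → a :- b :+ b := a) refl (+ part p i) (+ suc i))
          by = bead {x = y} j (solve 2 (λ a b → a :- b :+ b := a) refl (+ part p j) (+ suc j))
      in bead-exclusive y by (subst (Bead p) (trans
           (≡-by {f = -1ℤ ℤ.- y} (cong +_ eq)
             (solve 5 (λ a b s i j → con -1ℤ :- (b :- (con 1ℤ :+ j)) :+ (a :+ b) :=
                                     a :- (con 1ℤ :+ i) :- s :+ (con 1ℤ :+ (s :+ i :+ j))) refl
                (+ part p i) (+ part p j) (+ s) (+ i) (+ j)))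
           (sym (mirror-≡ y))) (closed x bx))

-- The level function

<-cong⇒≡ℤ : ∀ {i j : ℤ} → (∀ q → q ℤ.< i ⇔ q ℤ.< j) → i ≡ j
<-cong⇒≡ℤ h = ℤ.≤-antisym (ℤ.≮⇒≥ λ j<i → ℤ.<-irrefl refl (to (h _) j<i))
                          (ℤ.≮⇒≥ λ i<j → ℤ.<-irrefl refl (from (h _) i<j))

DownClosed : (ℤ → Set) → Set
DownClosed P = ∀ {q r} → q ℤ.≤ r → P r → P q

suc-down-closed : ∀ {P : ℤ → Set} → (∀ q → P (1ℤ ℤ.+ q) → P q) → DownClosed P
suc-down-closed {P} step {q} {r} q≤r Pr = go ℤ.∣ r ℤ.- q ∣ q (ℤ.0≤i⇒+∣i∣≡i (ℤ.i≤j⇒0≤j-i q≤r))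
  where
  go : ∀ n q → + n ≡ r ℤ.- q → P q
  go zero    q eq = subst P (≡-by (sym eq) (solve 2 (λ q r → q :+ (r :- q) := r :+ con 0ℤ) refl q r)) Pr
  go (suc n) q eq = step q (go n (1ℤ ℤ.+ q)
      (≡-by eq (solve 3 (λ n q r → r :- (con 1ℤ :+ q) :+ (con 1ℤ :+ n) := n :+ (r :- q)) refl (+ n) q r)))

threshold : ∀ {P : ℤ → Set} → Decidable P → DownClosed P → ∀ n q → P q → ¬ P (q ℤ.+ + n) →
  ∃ λ J → ∀ q → P q ⇔ q ℤ.< J
threshold {P} P? down zero q Pq ¬Pq = contradiction (subst P (sym (ℤ.+-identityʳ q)) Pq) ¬Pq
threshold {P} P? down (suc n) q Pq ¬Pq with P? (q ℤ.+ + n)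
... | no ¬P  = threshold P? down n q Pq ¬P
... | yes Pn = q ℤ.+ + suc n , λ r → mk⇔
  (λ Pr → ℤ.≰⇒> λ J≤r → ¬Pq (down J≤r Pr))
  (λ r<J → down (≤-by₁ (ℤ.i<j⇒suc[i]≤j r<J)
      (solve 3 (λ q n r → q :+ n :+ (con 1ℤ :+ r) := r :+ (q :+ (con 1ℤ :+ n))) refl q (+ n) r)) Pn)

-- On the beads x + q (s + 1) with x fixed, being closed under subtraction of
-- s + 1 means that q ranges over everything below some level.
LevelAt : List ℕ → ℕ → ℕ → ℤ → Set
LevelAt p s x J = ∀ q → Bead p (+ x ℤ.+ q ℤ.* + suc s) ⇔ q ℤ.< J

level-unique : ∀ {p s x J K} → LevelAt p s x J → LevelAt p s x K → J ≡ K
level-unique lJ lK = <-cong⇒≡ℤ λ q → mk⇔ (to (lK q) ∘ from (lJ q)) (to (lJ q) ∘ from (lK q))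

ClosedUnder : ℕ → List ℕ → Set
ClosedUnder s p = ∀ x → Bead p x → Bead p (x ℤ.- + s)

nonneg-* : ∀ m n → 0ℤ ℤ.≤ + m ℤ.* + n
nonneg-* m n = subst (0ℤ ℤ.≤_) (ℤ.pos-* m n) (+≤+ z≤n)

i-1<i : ∀ i → i ℤ.- 1ℤ ℤ.< i
i-1<i i = ℤ.suc[i]≤j⇒i<j (ℤ.≤-reflexive (solve 1 (λ i → con 1ℤ :+ (i :- con 1ℤ) := i) refl i))

module _ {p} (ip : IsPartition p) (sc : SelfConjugate p) {s} (closed : ClosedUnder (suc s) p) where

  level-exists : ∀ x → ∃ (LevelAt p s x)
  level-exists x = threshold (λ q → bead? ip sc _) (suc-down-closed λ q b →
      subst (Bead p) (solve 3 (λ x q s → x :+ (con 1ℤ :+ q) :* s :- s := x :+ q :* s) refl (+ x) q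
          (+ suc s)) (closed _ b))
    -- The search runs from q = -(x + N + 1), where x + q (s + 1) is below -N, up to q = N, where it
    -- is at least N. All beads are below N, and everything below -N is a bead.
    (suc (x + N + N)) (ℤ.- (+ suc (x + N)))
    (bead-low ip sc (ℤ.suc[i]≤j⇒i<j (≤-by₁ (nonneg-* (suc (x + N)) s)
      (solve 3 (λ x a s → :- a :+ con 0ℤ := con 1ℤ :+ (x :+ :- (con 1ℤ :+ (x :+ a)) :* (con 1ℤ :+ s)) :+
          (con 1ℤ :+ (x :+ a)) :* s)
        refl (+ x) (+ N) (+ s)))))
    (λ b → 1≰0 (≤-by₃ (ℤ.i<j⇒suc[i]≤j (bead-bounded (proj₁ ip) b)) (+≤+ (z≤n {x})) (nonneg-* N s)
      (solve 3 (λ x a s → con 0ℤ :+ (con 1ℤ :+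
          (x :+ (:- (con 1ℤ :+ (x :+ a)) :+ (con 1ℤ :+ (x :+ a :+ a))) :*
              (con 1ℤ :+ s)) :+ con 0ℤ :+ con 0ℤ) :=
                          con 1ℤ :+ (a :+ x :+ a :* s))
        refl (+ x) (+ N) (+ s))))
    where
    N : ℕ
    N = part p 0

  level : ℕ → ℤ
  level x = proj₁ (level-exists x)

  level-correct : ∀ x → LevelAt p s x (level x)
  level-correct x = proj₂ (level-exists x)

  level-period : ∀ x → 1ℤ ℤ.+ level (x + suc s) ≡ level x
  level-period x = <-cong⇒≡ℤ λ q → mk⇔
    (λ q< → to (level-correct x q) (subst (Bead p) (shift q)
        (from (level-correct (x + suc s) (q ℤ.- 1ℤ)) (lower q<))))
    (λ q< → raise (to (level-correct (x + suc s) (q ℤ.- 1ℤ))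
        (subst (Bead p) (sym (shift q)) (from (level-correct x q) q<))))
    where
    shift : ∀ q → + (x + suc s) ℤ.+ (q ℤ.- 1ℤ) ℤ.* + suc s ≡ + x ℤ.+ q ℤ.* + suc s
    shift q = solve 3 (λ x q t → x :+ t :+ (q :- con 1ℤ) :* t := x :+ q :* t) refl (+ x) q (+ suc s)
    lower : ∀ {q J} → q ℤ.< 1ℤ ℤ.+ J → q ℤ.- 1ℤ ℤ.< J
    lower {q} {J} q< = ℤ.suc[i]≤j⇒i<j (≤-by₁ (ℤ.i<j⇒suc[i]≤j q<)
      (solve 2 (λ q J → J :+ (con 1ℤ :+ q) := con 1ℤ :+ (q :- con 1ℤ) :+ (con 1ℤ :+ J)) refl q J))
    raise : ∀ {q J} → q ℤ.- 1ℤ ℤ.< J → q ℤ.< 1ℤ ℤ.+ J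
    raise {q} {J} q< = ℤ.suc[i]≤j⇒i<j (≤-by₁ (ℤ.i<j⇒suc[i]≤j q<)
      (solve 2 (λ q J → con 1ℤ :+ J :+ (con 1ℤ :+ (q :- con 1ℤ)) := con 1ℤ :+ q :+ J) refl q J))

  -- Reflection sends x + (-1 - q)(s + 1) to y + q (s + 1). So q lies below the level of `y` exactly
  -- when -1 - q does not lie below the level of `x`.
  level-mirror : ∀ {x y} → x + y ≡ s → level y ≡ ℤ.- level x
  level-mirror {x} {y} x+y≡s = <-cong⇒≡ℤ λ q → mk⇔
    (λ q< → flip (λ r< → to (bead-mirror ip sc _)
        (subst (Bead p) (sym (reflect q)) (from (level-correct y q) q<))
            (from (level-correct x (-1ℤ ℤ.- q)) r<)))
    (λ q< → to (level-correct y q) (subst (Bead p) (reflect q)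
        (from (bead-mirror ip sc _) λ b → unflip q< (to (level-correct x (-1ℤ ℤ.- q)) b))))
    where
    reflect : ∀ q → mirror (+ x ℤ.+ (-1ℤ ℤ.- q) ℤ.* + suc s) ≡ + y ℤ.+ q ℤ.* + suc s
    reflect q rewrite sym x+y≡s = trans (mirror-≡ _)
      (solve 3 (λ x y q → con -1ℤ :- (x :+ (con -1ℤ :- q) :* (con 1ℤ :+ (x :+ y))) := y :+ q :*
          (con 1ℤ :+ (x :+ y))) refl (+ x) (+ y) q)
    flip : ∀ {q J} → ¬ (-1ℤ ℤ.- q ℤ.< J) → q ℤ.< ℤ.- J
    flip {q} {J} h = ℤ.suc[i]≤j⇒i<j (≤-by₁ (ℤ.≮⇒≥ h)
        (solve 2 (λ q J → :- J :+ J := con 1ℤ :+ q :+ (con -1ℤ :- q)) refl q J))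
    unflip : ∀ {q J} → q ℤ.< ℤ.- J → ¬ (-1ℤ ℤ.- q ℤ.< J)
    unflip {q} {J} q< h = 1≰0 (≤-by₂ (ℤ.i<j⇒suc[i]≤j q<) (ℤ.i<j⇒suc[i]≤j h)
      (solve 2 (λ q J → con 0ℤ :+ (con 1ℤ :+ q :+ (con 1ℤ :+ (con -1ℤ :- q))) := con 1ℤ :+
          (:- J :+ J)) refl q J))

  -- Subtracting s (resp. s + 2) from a bead moves one residue up (resp. down)
  -- modulo s + 1 and lowers q by one.
  level-step-≥ : ClosedUnder s p → ∀ x → level x ℤ.≤ 1ℤ ℤ.+ level (suc x)
  level-step-≥ closed⁻ x = ≤-by₁ (ℤ.i<j⇒suc[i]≤j (to (level-correct (suc x) (J ℤ.- + 2))
      (subst (Bead p) (solve 3 (λ x J s → x :+ (J :- con 1ℤ) :* (con 1ℤ :+ s) :- s := con 1ℤ :+ x :+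
          (J :- con (+ 2)) :* (con 1ℤ :+ s)) refl (+ x) J (+ s))
        (closed⁻ _ (from (level-correct x (J ℤ.- 1ℤ)) (i-1<i J))))))
    (solve 2 (λ J K → con 1ℤ :+ K :+ (con 1ℤ :+ (J :- con (+ 2))) := J :+ K) refl J (level (suc x)))
    where
    J : ℤ
    J = level x

  level-step-≤ : ClosedUnder (suc (suc s)) p → ∀ x → level (suc x) ℤ.≤ 1ℤ ℤ.+ level x
  level-step-≤ closed⁺ x = ≤-by₁ (ℤ.i<j⇒suc[i]≤j (to (level-correct x (J ℤ.- + 2))
      (subst (Bead p) (solve 3 (λ x J s → con 1ℤ :+ x :+ (J :- con 1ℤ) :* (con 1ℤ :+ s) :-
          (con (+ 2) :+ s) := x :+ (J :- con (+ 2)) :* (con 1ℤ :+ s)) refl (+ x) J (+ s))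
        (closed⁺ _ (from (level-correct (suc x) (J ℤ.- 1ℤ)) (i-1<i J))))))
    (solve 2 (λ J K → con 1ℤ :+ K :+ (con 1ℤ :+ (J :- con (+ 2))) := J :+ K) refl J (level x))
    where
    J : ℤ
    J = level (suc x)

-- Words of steps

data Step : Set where
  rise flat fall : Step

δ : Step → ℤ
δ rise = 1ℤ
δ flat = 0ℤ
δ fall = -1ℤ

δ-injective : ∀ {σ τ} → δ σ ≡ δ τ → σ ≡ τ
δ-injective {rise} {rise} _ = refl
δ-injective {flat} {flat} _ = refl
δ-injective {fall} {fall} _ = refl

rises falls : ∀ {n} → Vec Step n → ℕ
rises []         = 0
rises (rise ∷ v) = suc (rises v)
rises (flat ∷ v) = rises v
rises (fall ∷ v) = rises v
falls []         = 0
falls (rise ∷ v) = falls v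
falls (flat ∷ v) = falls v
falls (fall ∷ v) = suc (falls v)

-- The height stays constant past the end of the word, so that neighbouring heights are adjacent at
-- every index.
height : ∀ {n} → Vec Step n → ℕ → ℤ
height []      i       = 0ℤ
height (σ ∷ v) zero    = 0ℤ
height (σ ∷ v) (suc i) = δ σ ℤ.+ height v i

height-zero : ∀ {n} (v : Vec Step n) → height v 0 ≡ 0ℤ
height-zero []      = refl
height-zero (σ ∷ v) = refl

height-end : ∀ {n} (v : Vec Step n) → height v n ≡ + rises v ℤ.- + falls v
height-end []         = refl
height-end (rise ∷ v) = trans (cong (λ t → 1ℤ ℤ.+ t) (height-end v))
    (solve 2 (λ a b → con 1ℤ :+ (a :- b) := con 1ℤ :+ a :- b) refl (+ rises v) (+ falls v))
height-end (flat ∷ v) = trans (ℤ.+-identityˡ _) (height-end v)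
height-end (fall ∷ v) = trans (cong (λ t → -1ℤ ℤ.+ t) (height-end v))
    (solve 2 (λ a b → con -1ℤ :+ (a :- b) := a :- (con 1ℤ :+ b)) refl (+ rises v) (+ falls v))

height-injective : ∀ {n} (v w : Vec Step n) → (∀ i → i ≤ n → height v i ≡ height w i) → v ≡ w
height-injective []      []      eq = refl
height-injective (σ ∷ v) (τ ∷ w) eq with δ-injective {σ} {τ} (begin
    δ σ                   ≡⟨ ℤ.+-identityʳ _ ⟨
    δ σ ℤ.+ 0ℤ            ≡⟨ cong (λ t → δ σ ℤ.+ t) (height-zero v) ⟨
    δ σ ℤ.+ height v 0    ≡⟨ eq 1 (s≤s z≤n) ⟩
    δ τ ℤ.+ height w 0    ≡⟨ cong (λ t → δ τ ℤ.+ t) (height-zero w) ⟩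
    δ τ ℤ.+ 0ℤ            ≡⟨ ℤ.+-identityʳ _ ⟩
    δ τ                   ∎)
  where open ≡-Reasoning
... | refl = cong (σ ∷_) (height-injective v w λ i i≤n → ≡-by (eq (suc i) (s≤s i≤n))
  (solve 3 (λ d a b → b :+ (d :+ a) := a :+ (d :+ b)) refl (δ σ) (height v i) (height w i)))

StepBetween : ℤ → ℤ → Set
StepBetween a b = ∃ λ σ → a ℤ.+ δ σ ≡ b

stepBetween : ∀ {a b} → b ℤ.≤ 1ℤ ℤ.+ a → a ℤ.≤ 1ℤ ℤ.+ b → StepBetween a b
stepBetween {a} {b} b≤ a≤ with ℤ.<-cmp a b
... | tri< a<b _ _ = rise , ℤ.≤-antisym
  (≤-by₁ (ℤ.i<j⇒suc[i]≤j a<b) (solve 2 (λ a b → b :+ (con 1ℤ :+ a) := a :+ con 1ℤ :+ b) refl a b))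
  (ℤ.≤-trans b≤ (ℤ.≤-reflexive (ℤ.+-comm 1ℤ a)))
... | tri≈ _ refl _ = flat , ℤ.+-identityʳ a
... | tri> _ _ b<a = fall , ℤ.≤-antisym
  (≤-by₁ a≤ (solve 2 (λ a b → b :+ a := a :+ con -1ℤ :+ (con 1ℤ :+ b)) refl a b))
  (≤-by₁ (ℤ.i<j⇒suc[i]≤j b<a) (solve 2 (λ a b → a :+ con -1ℤ :+ (con 1ℤ :+ b) := b :+ a) refl a b))

height-realises : ∀ n (h : ℕ → ℤ) → h 0 ≡ 0ℤ → (∀ i → i < n → StepBetween (h i) (h (suc i))) →
  ∃ λ (v : Vec Step n) → ∀ i → i ≤ n → height v i ≡ h i
height-realises zero    h h0 step = [] , λ { zero _ → sym h0 }
height-realises (suc n) h h0 step with step 0 z<s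
-- The remaining sequence starts at `δ σ` and is shifted down to start at 0.
... | σ , eqσ with height-realises n (λ i → h (suc i) ℤ.- δ σ)
    (trans (cong (ℤ._- δ σ) (trans (sym eqσ) (trans (cong (ℤ._+ δ σ) h0) (ℤ.+-identityˡ (δ σ)))))
        (ℤ.+-inverseʳ (δ σ)))
    (λ i i<n → let τ , eqτ = step (suc i) (s<s i<n) in
       τ , trans (solve 3 (λ a s t → a :- s :+ t := a :+ t :- s) refl (h (suc i)) (δ σ) (δ τ))
           (cong (ℤ._- δ σ) eqτ))
...   | v , eqv = σ ∷ v , λ
  { zero    _         → sym h0
  ; (suc i) (s≤s i≤n) → trans (cong (λ t → δ σ ℤ.+ t) (eqv i i≤n))
      (solve 2 (λ a s → s :+ (a :- s) := a) refl (h (suc i)) (δ σ)) }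

-- Counting words with given numbers of rises and falls

onPred : ∀ {A : Set} → (ℕ → List A) → ℕ → List A
onPred f zero    = []
onPred f (suc n) = f n

-- Splitting by the first letter makes the lengths obey the Pascal recurrence for trinomial
-- coefficients.
words : ∀ n → ℕ → ℕ → List (Vec Step n)
words zero    zero    zero    = [] ∷ []
words zero    zero    (suc d) = []
words zero    (suc u) d       = []
words (suc n) u       d       =
  map (flat ∷_) (words n u d) ++
  onPred (λ u → map (rise ∷_) (words n u d)) u ++
  onPred (λ d → map (fall ∷_) (words n u d)) d

∈-words⁺ : ∀ {n} (v : Vec Step n) → v ∈ words n (rises v) (falls v)
∈-words⁺ []         = here refl
∈-words⁺ {suc n} (flat ∷ v) = ∈-++⁺ˡ (∈-map⁺ (flat ∷_) (∈-words⁺ v))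
∈-words⁺ {suc n} (rise ∷ v) = ∈-++⁺ʳ (map (flat ∷_) (words n (suc (rises v)) (falls v)))
    (∈-++⁺ˡ (∈-map⁺ (rise ∷_) (∈-words⁺ v)))
∈-words⁺ {suc n} (fall ∷ v) = ∈-++⁺ʳ (map (flat ∷_) (words n (rises v) (suc (falls v))))
  (∈-++⁺ʳ (onPred (λ u → map (rise ∷_) (words n u (suc (falls v)))) (rises v))
      (∈-map⁺ (fall ∷_) (∈-words⁺ v)))

∈-onPred⁻ : ∀ {A : Set} {f : ℕ → List A} {n x} → x ∈ onPred f n → ∃ λ m → n ≡ suc m × x ∈ f m
∈-onPred⁻ {n = suc m} x∈ = m , refl , x∈

∈-words⁻ : ∀ n {u d} {v : Vec Step n} → v ∈ words n u d → rises v ≡ u × falls v ≡ d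
∈-words⁻ zero {zero} {zero} (here refl) = refl , refl
∈-words⁻ (suc n) {u} {d} v∈ with ∈-++⁻ (map (flat ∷_) (words n u d)) v∈
... | inj₁ v∈₁ with ∈-map⁻ (flat ∷_) v∈₁
...   | w , w∈ , refl = ∈-words⁻ n w∈
∈-words⁻ (suc n) {u} {d} v∈ | inj₂ v∈₂ with ∈-++⁻ (onPred (λ u → map (rise ∷_) (words n u d)) u) v∈₂
∈-words⁻ (suc n) {u} {d} v∈ | inj₂ _ | inj₁ v∈₃ with ∈-onPred⁻ {n = u} v∈₃
... | m , refl , v∈₄ with ∈-map⁻ (rise ∷_) v∈₄
...   | w , w∈ , refl = let r , f = ∈-words⁻ n w∈ in cong suc r , f
∈-words⁻ (suc n) {u} {d} v∈ | inj₂ _ | inj₂ v∈₃ with ∈-onPred⁻ {n = d} v∈₃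
... | m , refl , v∈₄ with ∈-map⁻ (fall ∷_) v∈₄
...   | w , w∈ , refl = let r , f = ∈-words⁻ n w∈ in r , cong suc f

words-unique : ∀ n u d → Unique (words n u d)
words-unique zero    zero    zero    = [] ∷ []
words-unique zero    zero    (suc d) = []
words-unique zero    (suc u) d       = []
words-unique (suc n) u       d       = Unique.++⁺ (prepended (words-unique n u d))
  (Unique.++⁺ (onPred-unique u λ u → prepended (words-unique n u d))
      (onPred-unique d λ d → prepended (words-unique n u d))
     λ (a , b) → rise≢fall (at-rise a) (at-fall b))
  λ (a , b) → [ (λ b → flat≢rise (at-flat a) (at-rise b)) , (λ b → flat≢fall (at-flat a) (at-fall b)) ]′
     (∈-++⁻ (onPred (λ u → map (rise ∷_) (words n u d)) u) b)
  where
  prepended : ∀ {σ} {ws : List (Vec Step n)} → Unique ws → Unique (map (σ ∷_) ws)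
  prepended = Unique.map⁺ Vec.∷-injectiveʳ
  onPred-unique : ∀ {f : ℕ → List (Vec Step (suc n))} k → (∀ j → Unique (f j)) → Unique (onPred f k)
  onPred-unique zero    _ = []
  onPred-unique (suc k) h = h k
  Starts : Step → Vec Step (suc n) → Set
  Starts σ v = ∃ λ w → v ≡ σ ∷ w
  starts : ∀ {σ ws v} → v ∈ map (σ ∷_) ws → Starts σ v
  starts v∈ = let w , _ , eq = ∈-map⁻ (_ ∷_) v∈ in w , eq
  at-flat : ∀ {v} → v ∈ map (flat ∷_) (words n u d) → Starts flat v
  at-flat = starts
  at-rise : ∀ {v} → v ∈ onPred (λ u → map (rise ∷_) (words n u d)) u → Starts rise v
  at-rise v∈ = starts (proj₂ (proj₂ (∈-onPred⁻ {n = u} v∈)))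
  at-fall : ∀ {v} → v ∈ onPred (λ d → map (fall ∷_) (words n u d)) d → Starts fall v
  at-fall v∈ = starts (proj₂ (proj₂ (∈-onPred⁻ {n = d} v∈)))
  rise≢fall : ∀ {v} → Starts rise v → ¬ Starts fall v
  rise≢fall (_ , refl) (_ , ())
  flat≢rise : ∀ {v} → Starts flat v → ¬ Starts rise v
  flat≢rise (_ , refl) (_ , ())
  flat≢fall : ∀ {v} → Starts flat v → ¬ Starts fall v
  flat≢fall (_ , refl) (_ , ())

wordCount : ℕ → ℕ → ℕ → ℕ
wordCount n u d = length (words n u d)

predCount : (ℕ → ℕ) → ℕ → ℕ
predCount f zero    = 0
predCount f (suc n) = f n

length-onPred : ∀ {A : Set} (f : ℕ → List A) n → length (onPred f n) ≡ predCount (length ∘ f) n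
length-onPred f zero    = refl
length-onPred f (suc n) = refl

predCount-cong : ∀ {f g : ℕ → ℕ} → (∀ n → f n ≡ g n) → ∀ n → predCount f n ≡ predCount g n
predCount-cong eq zero    = refl
predCount-cong eq (suc n) = eq n

wordCount-suc : ∀ n u d → wordCount (suc n) u d ≡
  wordCount n u d + (predCount (λ u → wordCount n u d) u + predCount (wordCount n u) d)
wordCount-suc n u d = trans (length-++ (map (flat ∷_) (words n u d)))
    (cong₂ _+_ (length-map _ (words n u d))
  (trans (length-++ (onPred (λ u → map (rise ∷_) (words n u d)) u)) (cong₂ _+_
    (trans (length-onPred _ u) (predCount-cong (λ u → length-map _ (words n u d)) u))
    (trans (length-onPred _ d) (predCount-cong (λ d → length-map _ (words n u d)) d)))))

rises+falls≤ : ∀ {n} (v : Vec Step n) → rises v + falls v ≤ n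
rises+falls≤ []         = z≤n
rises+falls≤ (rise ∷ v) = s≤s (rises+falls≤ v)
rises+falls≤ (flat ∷ v) = m≤n⇒m≤1+n (rises+falls≤ v)
rises+falls≤ {suc n} (fall ∷ v) = subst (_≤ suc n) (sym (+-suc _ _)) (s≤s (rises+falls≤ v))

wordCount-zero : ∀ n {u d} → n < u + d → wordCount n u d ≡ 0
wordCount-zero n {u} {d} n<u+d with words n u d in eq
... | []    = refl
... | v ∷ _ with ∈-words⁻ n {u} {d} (subst (v ∈_) (sym eq) (here refl))
...   | refl , refl = contradiction (rises+falls≤ v) (<⇒≱ n<u+d)

-- Here `z` is the number of flat letters. After multiplication by the factorials, words starting
-- with a rise, a fall or a flat contribute u n!, d n! and z n!. For `z` equal to zero the flat part
-- vanishes because `u + d` exceeds the remaining length.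
wordCount-! : ∀ n u d z → u + d + z ≡ n → wordCount n u d * (u ! * d ! * z !) ≡ n !
wordCount-! zero    zero    zero    zero refl = refl
wordCount-! (suc n) u d z eq = begin
  wordCount (suc n) u d * D
    ≡⟨ cong (_* D) (wordCount-suc n u d) ⟩
  (wordCount n u d + (predCount (λ u → wordCount n u d) u + predCount (wordCount n u) d)) * D
    ≡⟨ distrib (wordCount n u d) (predCount (λ u → wordCount n u d) u) (predCount (wordCount n u) d) D ⟩
  predCount (λ u → wordCount n u d) u * D + predCount (wordCount n u) d * D + wordCount n u d * D
    ≡⟨ cong₂ _+_ (cong₂ _+_ (by-u u eq) (by-d d eq)) (by-z z eq) ⟩
  u * n ! + d * n ! + z * n !
    ≡⟨ collect u d z (n !) ⟩
  (u + d + z) * n !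
    ≡⟨ cong (_* n !) eq ⟩
  suc n ! ∎
  where
  open ≡-Reasoning
  D : ℕ
  D = u ! * d ! * z !
  distrib : ∀ a b c D → (a + (b + c)) * D ≡ b * D + c * D + a * D
  distrib = solve-∀
  collect : ∀ u d z f → u * f + d * f + z * f ≡ (u + d + z) * f
  collect = solve-∀
  pull-u : ∀ c u f g h → c * (suc u * f * g * h) ≡ suc u * (c * (f * g * h))
  pull-u = solve-∀
  pull-d : ∀ c d f g h → c * (f * (suc d * g) * h) ≡ suc d * (c * (f * g * h))
  pull-d = solve-∀
  pull-z : ∀ c z f g h → c * (f * g * (suc z * h)) ≡ suc z * (c * (f * g * h))
  pull-z = solve-∀
  by-u : ∀ u → u + d + z ≡ suc n → predCount (λ u → wordCount n u d) u * (u ! * d ! * z !) ≡ u * n !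
  by-u zero    _  = refl
  by-u (suc u) eq = trans
    (pull-u (wordCount n u d) u (u !) (d !) (z !))
    (cong (suc u *_) (wordCount-! n u d z (suc-injective eq)))
  by-d : ∀ d → u + d + z ≡ suc n → predCount (wordCount n u) d * (u ! * d ! * z !) ≡ d * n !
  by-d zero    _  = refl
  by-d (suc d) eq = trans
    (pull-d (wordCount n u d) d (u !) (d !) (z !))
    (cong (suc d *_) (wordCount-! n u d z (suc-injective (trans (cong (_+ z) (sym (+-suc u d))) eq))))
  by-z : ∀ z → u + d + z ≡ suc n → wordCount n u d * (u ! * d ! * z !) ≡ z * n !
  by-z zero    eq = cong (_* (u ! * d ! * 1))
      (wordCount-zero n (≤-reflexive (trans (sym eq) (+-identityʳ _))))
  by-z (suc z) eq = trans
    (pull-z (wordCount n u d) z (u !) (d !) (z !))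
    (cong (suc z *_) (wordCount-! n u d z (suc-injective (trans (sym (+-suc _ z)) eq))))

multinomial-exact : ∀ n a b c L → L * (a ! * b ! * c !) ≡ n ! → L ≡ multinomial n (+ a) (+ b) (+ c)
multinomial-exact n a b c L eq = trans (sym (m*n/n≡m L D)) (cong (_/ D) eq)
  where
  D : ℕ
  D = a ! * b ! * c !
  instance
    D≢0 : NonZero D
    D≢0 = m*n≢0 (a ! * b !) (c !) {{a !* b !≢0}} {{c !≢0}}

wordCount-multinomial : ∀ k m a b → a + b ≡ m → wordCount k b a ≡ multinomial k (+ a) (+ b) (+ k ℤ.- + m)
wordCount-multinomial k m a b a+b≡m with m ≤? k
... | yes m≤k = trans
  (multinomial-exact k a b (k ∸ m) (wordCount k b a)
      (trans (cong (λ t → wordCount k b a * (t * (k ∸ m) !)) (*-comm (a !) (b !)))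
    (wordCount-! k b a (k ∸ m) (trans (cong (_+ (k ∸ m)) (trans (+-comm b a) a+b≡m)) (m+[n∸m]≡n m≤k)))))
  (cong (multinomial k (+ a) (+ b)) (sym (trans (ℤ.m-n≡m⊖n k m) (ℤ.⊖-≥ m≤k))))
... | no m≰k = trans
  (wordCount-zero k (subst (k <_) (trans (sym a+b≡m) (+-comm a b)) k<m))
  (cong (multinomial k (+ a) (+ b)) (sym
      (trans (ℤ.m-n≡m⊖n k m) (trans (ℤ.⊖-< k<m) (cong (λ t → ℤ.- + t) m∸k≡)))))
  where
  k<m : k < m
  k<m = ≰⇒> m≰k
  -- The visible successor turns the third entry into a `-[1+_]`, on which `multinomial` computes to
  -- 0.
  m∸k≡ : m ∸ k ≡ suc (m ∸ suc k)
  m∸k≡ = +-∸-assoc 1 k<m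

-- A self-conjugate partition with prescribed nonnegative beads

leading : ∀ {P : ℕ → Set} → Decidable P → ℕ → ℕ
leading P? zero    = 0
leading P? (suc n) with P? 0
... | yes _ = suc (leading (P? ∘ suc) n)
... | no _  = 0

leading-⇔ : ∀ {P : ℕ → Set} (P? : Decidable P) n → (∀ j → P (suc j) → P j) → (∀ j → P j → j < n) →
  ∀ j → j < leading P? n ⇔ P j
leading-⇔ P? zero    down bound j = mk⇔ (λ ()) (λ Pj → contradiction (bound j Pj) n≮0)
leading-⇔ {P} P? (suc n) down bound j with P? 0
... | no ¬P0 = mk⇔ (λ ()) (λ Pj → contradiction (to-zero j Pj) ¬P0)
  where
  to-zero : ∀ j → P j → P 0
  to-zero zero    P0 = P0
  to-zero (suc j) Pj = to-zero j (down j Pj)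
leading-⇔ P? (suc n) down bound zero    | yes P0 = mk⇔ (λ _ → P0) (λ _ → z<s)
leading-⇔ P? (suc n) down bound (suc j) | yes P0 = mk⇔ (to rec ∘ s<s⁻¹) (s<s ∘ from rec)
  where rec = leading-⇔ (P? ∘ suc) n (down ∘ suc) (λ j → s<s⁻¹ ∘ bound (suc j)) j

bit : ∀ {A : Set} → Dec A → ℕ
bit (yes _) = 1
bit (no _)  = 0

bit≤1 : ∀ {A : Set} (a? : Dec A) → bit a? ≤ 1
bit≤1 (yes _) = ≤-refl
bit≤1 (no _)  = z≤n

-- The self-conjugate partition whose nonnegative beads are the elements of B:
-- the diagonal j − i = c (and its mirror image) has one box for each element
-- of B that is at least c.
module Diagram {B : ℕ → Set} (B? : Decidable B) (N : ℕ) (bound : ∀ x → B x → x < N) where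

  countFrom : ℕ → ℕ → ℕ
  countFrom zero    c = 0
  countFrom (suc n) c = bit (B? c) + countFrom n (suc c)

  countFrom-≤ : ∀ n c → countFrom n c ≤ n
  countFrom-≤ zero    c = z≤n
  countFrom-≤ (suc n) c = +-mono-≤ (bit≤1 (B? c)) (countFrom-≤ n (suc c))

  diagonal : ℕ → ℕ
  diagonal c = countFrom (N ∸ c) c

  diagonal-suc : ∀ c → diagonal c ≡ bit (B? c) + diagonal (suc c)
  diagonal-suc c with c <? N
  ... | yes c<N rewrite +-∸-assoc 1 c<N = refl
  ... | no c≮N with B? c
  ...   | yes Bc = contradiction (bound c Bc) c≮N
  ...   | no _ rewrite m≤n⇒m∸n≡0 (≮⇒≥ c≮N) | m≤n⇒m∸n≡0 (m≤n⇒m≤1+n (≮⇒≥ c≮N)) = refl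

  diagonal-≥ : ∀ c → diagonal (suc c) ≤ diagonal c
  diagonal-≥ c = subst (diagonal (suc c) ≤_) (sym (diagonal-suc c)) (m≤n+m _ (bit (B? c)))

  diagonal-≤ : ∀ c → diagonal c ≤ suc (diagonal (suc c))
  diagonal-≤ c = subst (_≤ suc (diagonal (suc c))) (sym (diagonal-suc c)) (+-monoˡ-≤ _ (bit≤1 (B? c)))

  -- The box (i, j) is number `i ⊓ j`, counted from 0, on its diagonal. The formula is symmetric in
  -- `i` and `j`, so self-conjugacy is built in.
  Cell : ℕ → ℕ → Set
  Cell i j = i ⊓ j < diagonal ∣ i - j ∣

  cell-sym : ∀ i j → Cell i j → Cell j i
  cell-sym i j = subst₂ (λ a b → a < diagonal b) (⊓-comm i j) (∣-∣-comm i j)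

  -- To the right of the main diagonal, a move left keeps the number on the diagonal and reaches one
  -- that is at least as long. To the left of it, the number drops by one and the diagonal shortens
  -- by at most one. The offset `e` collects the common successors stripped from `i` and `j`.
  cell-left : ∀ i j → Cell i (suc j) → Cell i j
  cell-left = shifted 0
    where
    shifted : ∀ e i j → e + (i ⊓ suc j) < diagonal ∣ i - suc j ∣ → e + (i ⊓ j) < diagonal ∣ i - j ∣
    shifted e zero    j       h = <-≤-trans h (diagonal-≥ j)
    shifted e (suc i) zero    h rewrite ⊓-zeroʳ i | ∣-∣-identityʳ i | +-suc e 0 = s≤s⁻¹
        (≤-trans h (diagonal-≤ i))
    shifted e (suc i) (suc j) h rewrite +-suc e (i ⊓ suc j) | +-suc e (i ⊓ j) = shifted (suc e) i j h

  cell-up : ∀ i j → Cell (suc i) j → Cell i j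
  cell-up i j = cell-sym j i ∘ cell-left j i ∘ cell-sym (suc i) j

  cell-bound : ∀ i j → Cell i j → j < N
  cell-bound i j h = ≤-<-trans (≤-⊓+∣-∣ i j)
    (m≤o∸n⇒m+n≤o (suc (i ⊓ j)) {∣ i - j ∣} {N} (<⇒≤ (m<n∸o⇒o<n (<-≤-trans h (countFrom-≤ _ _))))
        (<-≤-trans h (countFrom-≤ _ _)))
    where
    ≤-⊓+∣-∣ : ∀ i j → j ≤ i ⊓ j + ∣ i - j ∣
    ≤-⊓+∣-∣ zero    j       = ≤-refl
    ≤-⊓+∣-∣ (suc i) zero    = z≤n
    ≤-⊓+∣-∣ (suc i) (suc j) = s≤s (≤-⊓+∣-∣ i j)
    m<n∸o⇒o<n : ∀ {m n o} → m < n ∸ o → o < n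
    m<n∸o⇒o<n {m} {n} {o} m< = ≰⇒> λ n≤o → n≮0 (subst (m <_) (m≤n⇒m∸n≡0 n≤o) m<)

  row : ℕ → ℕ
  row i = leading (λ j → i ⊓ j <? diagonal ∣ i - j ∣) N

  row-⇔ : ∀ i j → j < row i ⇔ Cell i j
  row-⇔ i = leading-⇔ _ N (cell-left i) (cell-bound i)

  row-antitone : Antitone row
  row-antitone i = ≮⇒≥ λ r< → <-irrefl refl (from (row-⇔ i _) (cell-up i _ (to (row-⇔ (suc i) _) r<)))

  row-N : row N ≡ 0
  row-N = n≤0⇒n≡0 (≮⇒≥ λ 0<r → <-irrefl refl (cell-bound 0 N (cell-sym N 0 (to (row-⇔ N 0) 0<r))))

  diagram : List ℕ
  diagram = fromParts N row

  diagram-partition : IsPartition diagram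
  diagram-partition = fromParts-partition N row-antitone row-N

  box⇔cell : ∀ i j → Box diagram i j ⇔ Cell i j
  box⇔cell i j rewrite part-fromParts N row-antitone row-N i = row-⇔ i j

  diagram-selfConjugate : SelfConjugate diagram
  diagram-selfConjugate i j = mk⇔ (from (box⇔cell j i) ∘ cell-sym i j ∘ to (box⇔cell i j))
                                  (from (box⇔cell i j) ∘ cell-sym j i ∘ to (box⇔cell j i))

  box-diagonal : ∀ i c → Box diagram i (c + i) ⇔ i < diagonal c
  box-diagonal i c = subst₂ (λ a b → Box diagram i (c + i) ⇔ a < diagonal b)
    (m≤n⇒m⊓n≡m (m≤n+m i c)) (trans (cong (∣ i -_∣) (+-comm c i)) (∣m-m+n∣≡n i c)) (box⇔cell i (c + i))

  -- Row i ends on diagonal x when i is below `diagonal x` but not below `diagonal (suc x)`. These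
  -- two counts differ only if `B x` holds, and then i is `diagonal (suc x)`.
  diagram-bead : ∀ x → Bead diagram (+ x) ⇔ B x
  diagram-bead x = mk⇔ forth back
    where
    forth : Bead diagram (+ x) → B x
    forth (bead i eq) with B? x | diagonal-suc x
    ... | yes Bx | _ = Bx
    ... | no _   | same = contradiction (to (box-diagonal i x)
        (subst (x + i <_) row≡ (≤-reflexive (sym (+-suc x i)))))
          (≤⇒≯ (≤-trans (≤-reflexive same) (≮⇒≥ λ i< → <-irrefl (trans (sym (+-suc x i)) row≡)
              (from (box-diagonal i (suc x)) i<))))
      where
      row≡ : x + suc i ≡ part diagram i
      row≡ = ℤ.+-injective eq
    back : B x → Bead diagram (+ x)
    back Bx = bead i (cong +_ (trans (+-suc x i) (≤-antisym
        (from (box-diagonal i x) (subst (i <_) (sym one-more) (n<1+n i)))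
        (≮⇒≥ (λ lt → <-irrefl refl (to (box-diagonal i (suc x)) lt))))))
      where
      i : ℕ
      i = diagonal (suc x)
      one-more : diagonal x ≡ suc i
      one-more with B? x | diagonal-suc x
      ... | yes _  | eq = eq
      ... | no ¬Bx | _  = contradiction Bx ¬Bx

-- From levels on one period to closure, and from words to partitions

residue : ∀ s x → ∃₂ λ r q → r ≤ s × x ≡ + r ℤ.+ q ℤ.* + suc s
residue s x = x ℤ.%ℕ suc s , x ℤ./ℕ suc s , s≤s⁻¹ (ℤ.n%ℕd<d x (suc s)) , ℤ.a≡a%ℕn+[a/ℕn]*n x (suc s)

levels-determine : ∀ {p q s} {f : ℕ → ℤ} → IsPartition p → IsPartition q →
  (∀ r → r ≤ s → LevelAt p s r (f r)) → (∀ r → r ≤ s → LevelAt q s r (f r)) → p ≡ q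
levels-determine {p} {q} {s} ip iq lp lq = bead-ext ip iq λ x → agree (residue s x)
  where
  agree : ∀ {x} → (∃₂ λ r a → r ≤ s × x ≡ + r ℤ.+ a ℤ.* + suc s) → Bead p x ⇔ Bead q x
  agree (r , a , r≤s , refl) = mk⇔ (from (lq r r≤s a) ∘ to (lp r r≤s a))
      (from (lp r r≤s a) ∘ to (lq r r≤s a))

Adjacent : ℤ → ℤ → Set
Adjacent a b = a ℤ.≤ 1ℤ ℤ.+ b × b ℤ.≤ 1ℤ ℤ.+ a

adjacent-refl : ∀ {a} → Adjacent a a
adjacent-refl = ℤ.i≤suc[i] _ , ℤ.i≤suc[i] _

<-by₂ : ∀ {a b c d e f} → a ℤ.< b → c ℤ.≤ d → 1ℤ ℤ.+ f ℤ.+ (a ℤ.+ c) ≡ 1ℤ ℤ.+ e ℤ.+ (b ℤ.+ d) → e ℤ.< f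
<-by₂ {a} {b} {c} {d} {e} {f} a<b c≤d eq = ℤ.suc[i]≤j⇒i<j (≤-by₂ (ℤ.i<j⇒suc[i]≤j a<b) c≤d
  (trans (solve 3 (λ f a c → f :+ (con 1ℤ :+ a :+ c) := con 1ℤ :+ f :+ (a :+ c)) refl f a c) eq))

-- Inside the period adjacency suffices. Two moves wrap around: subtracting s from residue s leads
-- to residue 0 with the same q, which needs -f 0 ≤ f 0; subtracting s + 2 from residue 0 leads to
-- residue s with q - 2, which needs f 0 - 2 ≤ -f 0.
levels-closed : ∀ {p s} {f : ℕ → ℤ} → (∀ r → r ≤ s → LevelAt p s r (f r)) →
  (∀ r → r < s → Adjacent (f r) (f (suc r))) → f s ≡ ℤ.- f 0 → 0ℤ ℤ.≤ f 0 → f 0 ℤ.≤ 1ℤ →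
  ClosedUnder s p × ClosedUnder (suc s) p × ClosedUnder (suc (suc s)) p
levels-closed {p} {s} {f} lv adj end 0≤f f≤1 = by-s , by-1+s , by-2+s
  where
  move : ∀ {x y r q r′ q′} → r ≤ s → r′ ≤ s → x ≡ + r ℤ.+ q ℤ.* + suc s → y ≡ + r′ ℤ.+ q′ ℤ.* + suc s →
    (q ℤ.< f r → q′ ℤ.< f r′) → Bead p x → Bead p y
  move {q = q} {q′ = q′} r≤ r′≤ refl refl h b = from (lv _ r′≤ q′) (h (to (lv _ r≤ q) b))
  by-s : ClosedUnder s p
  by-s x b with residue s x
  ... | r , q , r≤s , refl with r <? s
  ...   | yes r<s = move {q = q} {q′ = q ℤ.- 1ℤ} r≤s r<s refl
           (solve 3 (λ r q s → r :+ q :* (con 1ℤ :+ s) :- s := con 1ℤ :+ r :+ (q :- con 1ℤ) :*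
               (con 1ℤ :+ s)) refl (+ r) q (+ s))
           (λ q< → <-by₂ q< (proj₁ (adj r r<s))
               (solve 3 (λ a b q → con 1ℤ :+ b :+ (q :+ a) := con 1ℤ :+ (q :- con 1ℤ) :+
                   (a :+ (con 1ℤ :+ b))) refl (f r) (f (suc r)) q))
           b
  ...   | no r≮s with ≤-antisym r≤s (≮⇒≥ r≮s)
  ...     | refl = move {q = q} {q′ = q} r≤s z≤n refl
           (solve 2 (λ s q → s :+ q :* (con 1ℤ :+ s) :- s := con 0ℤ :+ q :* (con 1ℤ :+ s)) refl (+ s) q)
           (λ q< → <-by₂ (subst (q ℤ.<_) end q<) (ℤ.+-mono-≤ 0≤f 0≤f)
             (solve 2 (λ a q → con 1ℤ :+ a :+ (q :+ con 0ℤ) := con 1ℤ :+ q :+ (:- a :+ (a :+ a))) refl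
                 (f 0) q))
           b
  by-1+s : ClosedUnder (suc s) p
  by-1+s x b with residue s x
  ... | r , q , r≤s , refl = move {q = q} {q′ = q ℤ.- 1ℤ} r≤s r≤s refl
           (solve 3 (λ r q s → r :+ q :* s :- s := r :+ (q :- con 1ℤ) :* s) refl (+ r) q (+ suc s))
           (ℤ.<-trans (i-1<i q)) b
  by-2+s : ClosedUnder (suc (suc s)) p
  by-2+s x b with residue s x
  ... | suc r , q , r<s , refl = move {q = q} {q′ = q ℤ.- 1ℤ} r<s (<⇒≤ r<s) refl
           (solve 3 (λ r q s → con 1ℤ :+ r :+ q :* (con 1ℤ :+ s) :- (con (+ 2) :+ s) := r :+
               (q :- con 1ℤ) :* (con 1ℤ :+ s)) refl (+ r) q (+ s))
           (λ q< → <-by₂ q< (proj₂ (adj r r<s))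
               (solve 3 (λ a b q → con 1ℤ :+ a :+ (q :+ b) := con 1ℤ :+ (q :- con 1ℤ) :+
                   (b :+ (con 1ℤ :+ a))) refl (f r) (f (suc r)) q))
           b
  ... | zero , q , _ , refl = move {q = q} {q′ = q ℤ.- + 2} z≤n ≤-refl refl
           (solve 2 (λ q s → con 0ℤ :+ q :* (con 1ℤ :+ s) :- (con (+ 2) :+ s) := s :+
               (q :- con (+ 2)) :* (con 1ℤ :+ s)) refl q (+ s))
           (λ q< → subst (q ℤ.- + 2 ℤ.<_) (sym end) (<-by₂ q< (ℤ.+-mono-≤ f≤1 f≤1)
             (solve 2 (λ a q → con 1ℤ :+ :- a :+ (q :+ (a :+ a)) := con 1ℤ :+ (q :- con (+ 2)) :+
                 (a :+ con (+ 2))) refl (f 0) q)))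
           b

δ-adjacent : ∀ σ a → Adjacent a (δ σ ℤ.+ a)
δ-adjacent rise a = ≤-by₁ (+≤+ (z≤n {2}))
    (solve 1 (λ a → con 1ℤ :+ (con 1ℤ :+ a) :+ con 0ℤ := a :+ con (+ 2)) refl a) , ℤ.≤-refl
δ-adjacent flat a rewrite ℤ.+-identityˡ a = adjacent-refl
δ-adjacent fall a = ≤-by₁ (ℤ.≤-refl {0ℤ})
    (solve 1 (λ a → con 1ℤ :+ (con -1ℤ :+ a) :+ con 0ℤ := a :+ con 0ℤ) refl a) ,
                    ≤-by₁ (+≤+ (z≤n {2})) (solve 1 (λ a → con 1ℤ :+ a :+ con 0ℤ := con -1ℤ :+ a :+ con
                        (+ 2)) refl a)

adjacent-+ˡ : ∀ c {a b} → Adjacent a b → Adjacent (c ℤ.+ a) (c ℤ.+ b)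
adjacent-+ˡ c {a} {b} (a≤ , b≤) =
  ≤-by₁ a≤ (solve 3 (λ a b c → con 1ℤ :+ (c :+ b) :+ a := c :+ a :+ (con 1ℤ :+ b)) refl a b c) ,
  ≤-by₁ b≤ (solve 3 (λ a b c → con 1ℤ :+ (c :+ a) :+ b := c :+ b :+ (con 1ℤ :+ a)) refl a b c)

adjacent-neg : ∀ {a b} → Adjacent a b → Adjacent (ℤ.- b) (ℤ.- a)
adjacent-neg {a} {b} (a≤ , b≤) =
  ≤-by₁ a≤ (solve 2 (λ a b → con 1ℤ :+ :- a :+ a := :- b :+ (con 1ℤ :+ b)) refl a b) ,
  ≤-by₁ b≤ (solve 2 (λ a b → con 1ℤ :+ :- b :+ b := :- a :+ (con 1ℤ :+ a)) refl a b)

adjacent-sym : ∀ {a b} → Adjacent a b → Adjacent b a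
adjacent-sym (a , b) = b , a

height-adjacent : ∀ {n} (v : Vec Step n) i → Adjacent (height v i) (height v (suc i))
height-adjacent []      i       = adjacent-refl
height-adjacent (σ ∷ v) zero    rewrite height-zero v = δ-adjacent σ 0ℤ
height-adjacent (σ ∷ v) (suc i) = adjacent-+ˡ (δ σ) (height-adjacent v i)

height-bounds : ∀ {n} (v : Vec Step n) i → height v i ℤ.≤ + n × ℤ.- height v i ℤ.≤ + n
height-bounds []      i    = +≤+ z≤n , +≤+ z≤n
height-bounds (σ ∷ v) zero = +≤+ z≤n , +≤+ z≤n
height-bounds {suc n} (σ ∷ v) (suc i) with height-bounds v i
... | h≤ , -h≤ = ≤-by₂ (proj₁ (bounds σ)) h≤
    (solve 3 (λ d h n → con 1ℤ :+ n :+ (d :+ h) := d :+ h :+ (con 1ℤ :+ n)) refl (δ σ) (height v i) (+ n)) ,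
                 ≤-by₂ (proj₂ (bounds σ)) -h≤ (solve 3
                     (λ d h n → con 1ℤ :+ n :+ (:- d :+ :- h) := :- (d :+ h) :+ (con 1ℤ :+ n)) refl
                         (δ σ) (height v i) (+ n))
  where
  bounds : ∀ σ → δ σ ℤ.≤ 1ℤ × ℤ.- δ σ ℤ.≤ 1ℤ
  bounds rise = ℤ.≤-refl , -≤+
  bounds flat = +≤+ z≤n , +≤+ z≤n
  bounds fall = -≤+ , ℤ.≤-refl

-- The word v lists the steps of the level function from position k down to
-- position 0; since k ∸ r or k ∸ (s ∸ r) vanishes, the difference below is the
-- odd extension of the resulting heights about the midpoint of [0, s].
profile : ∀ {k} → ℕ → Vec Step k → ℕ → ℤ
profile {k} s v r = height v (k ∸ r) ℤ.- height v (k ∸ (s ∸ r))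

module _ {k s} (2k≤s : k + k ≤ s) (v : Vec Step k) where

  private
    half : ∀ {r} → r ≤ k → k ∸ (s ∸ r) ≡ 0
    half {r} r≤k = m≤n⇒m∸n≡0 (m+n≤o⇒m≤o∸n k (≤-trans (+-monoʳ-≤ k r≤k) 2k≤s))

  profile-low : ∀ {r} → r ≤ k → profile s v r ≡ height v (k ∸ r)
  profile-low {r} r≤k rewrite half r≤k | height-zero v = ℤ.+-identityʳ _

  profile-high : ∀ {r} → k ≤ r → profile s v r ≡ ℤ.- height v (k ∸ (s ∸ r))
  profile-high {r} k≤r rewrite m≤n⇒m∸n≡0 k≤r | height-zero v = ℤ.+-identityˡ _

  profile-mirror : ∀ {r} → r ≤ s → profile s v (s ∸ r) ≡ ℤ.- profile s v r
  profile-mirror {r} r≤s rewrite m∸[m∸n]≡n r≤s =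
    solve 2 (λ a b → a :- b := :- (b :- a)) refl (height v (k ∸ (s ∸ r))) (height v (k ∸ r))

  private
    descend : ∀ a → Adjacent (height v (k ∸ a)) (height v (k ∸ suc a))
    descend a with a <? k
    ... | yes a<k rewrite +-∸-assoc 1 a<k = adjacent-sym (height-adjacent v (k ∸ suc a))
    ... | no a≮k rewrite m≤n⇒m∸n≡0 (≮⇒≥ a≮k) | m≤n⇒m∸n≡0 (m≤n⇒m≤1+n (≮⇒≥ a≮k)) = adjacent-refl

  profile-adjacent : ∀ r → r < s → Adjacent (profile s v r) (profile s v (suc r))
  profile-adjacent r r<s with r <? k
  ... | yes r<k = subst₂ Adjacent (sym (profile-low (<⇒≤ r<k))) (sym (profile-low r<k)) (descend r)
  ... | no r≮k = subst₂ Adjacent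
      (sym (trans (profile-high (≮⇒≥ r≮k)) (cong (λ t → ℤ.- height v (k ∸ t)) (+-∸-assoc 1 r<s))))
      (sym (profile-high (m≤n⇒m≤1+n (≮⇒≥ r≮k))))
      (adjacent-neg (descend (s ∸ suc r)))

  private
    B : ℕ → Set
    B x = + (x / suc s) ℤ.< profile s v (x % suc s)

    -- Both heights in `profile` are at most `k` in absolute value, so the quotient of an element of
    -- `B` is below `k + k`.
    B-bound : ∀ x → B x → x < (k + k) * suc s
    B-bound x Bx = begin-strict
      x                                       ≡⟨ m≡m%n+[m/n]*n x (suc s) ⟩
      x % suc s + x / suc s * suc s           <⟨ +-monoˡ-< _ (m%n<n x (suc s)) ⟩
      suc (x / suc s) * suc s                 ≤⟨ *-monoˡ-≤ (suc s)
          (ℤ.drop‿+≤+ (ℤ.i<j⇒suc[i]≤j (ℤ.<-≤-trans Bx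
                                                   (ℤ.+-mono-≤ (proj₁ (height-bounds v (k ∸ (x % suc s)))) (proj₂ (height-bounds v (k ∸ (s ∸ x % suc s)))))))) ⟩
      (k + k) * suc s                         ∎
      where open ≤-Reasoning

    module D = Diagram {B} (λ x → _ ℤ.<? _) ((k + k) * suc s) B-bound

    remainder : ∀ r n → r ≤ s → (r + n * suc s) % suc s ≡ r
    remainder r n r≤s = trans ([m+kn]%n≡m%n r n (suc s)) (m<n⇒m%n≡m (s≤s r≤s))

    quotient : ∀ r n → r ≤ s → (r + n * suc s) / suc s ≡ n
    quotient r n r≤s = trans (+-distrib-/-∣ʳ r (divides n refl))
        (cong₂ _+_ (m<n⇒m/n≡0 (s≤s r≤s)) (m*n/n≡m n (suc s)))

    B-⇔ : ∀ {r} n → r ≤ s → B (r + n * suc s) ⇔ + n ℤ.< profile s v r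
    B-⇔ {r} n r≤s rewrite remainder r n r≤s | quotient r n r≤s = mk⇔ (λ z → z) (λ z → z)

  partition : List ℕ
  partition = D.diagram

  partition-isPartition : IsPartition partition
  partition-isPartition = D.diagram-partition

  partition-selfConjugate : SelfConjugate partition
  partition-selfConjugate = D.diagram-selfConjugate

  -- For q = -(n + 1) the number in question is the mirror image of (s - r) + n (s + 1), whose
  -- status is prescribed by `B`; the oddness of `profile` translates the answer back.
  partition-level : ∀ r → r ≤ s → LevelAt partition s r (profile s v r)
  partition-level r r≤s (+ n) rewrite sym (ℤ.pos-* n (suc s)) =
    mk⇔ (to (B-⇔ n r≤s) ∘ to (D.diagram-bead _)) (from (D.diagram-bead _) ∘ from (B-⇔ n r≤s))
  partition-level r r≤s -[1+ n ] = mk⇔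
    (λ b → unmirror λ n< → to (bead-mirror partition-isPartition partition-selfConjugate (+ y))
        (subst (Bead partition) x≡ b)
             (from (D.diagram-bead y) (from (B-⇔ n (m∸n≤m s r)) n<)))
    (λ n< → subst (Bead partition) (sym x≡)
        (from (bead-mirror partition-isPartition partition-selfConjugate (+ y))
             λ b → unmirror′ n< (to (B-⇔ n (m∸n≤m s r)) (to (D.diagram-bead y) b))))
    where
    y : ℕ
    y = s ∸ r + n * suc s
    x≡ : + r ℤ.+ -[1+ n ] ℤ.* + suc s ≡ mirror (+ y)
    x≡ = sym (trans (mirror-≡ (+ y)) (trans (cong (λ t → -1ℤ ℤ.- (+ (s ∸ r) ℤ.+ t)) (ℤ.pos-* n (suc s)))
      (trans (solve 4 (λ y n s r → con -1ℤ :- (y :+ n :* (con 1ℤ :+ s)) := r :+ (:- (con 1ℤ :+ n)) :*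
          (con 1ℤ :+ s) :+ (s :- (r :+ y))) refl (+ (s ∸ r)) (+ n) (+ s) (+ r))
      (trans (cong (λ t → + r ℤ.+ -[1+ n ] ℤ.* + suc s ℤ.+ (+ s ℤ.- t)) (cong +_ (m+[n∸m]≡n r≤s)))
      (solve 2 (λ a s → a :+ (s :- s) := a) refl (+ r ℤ.+ -[1+ n ] ℤ.* + suc s) (+ s))))))
    unmirror : ¬ (+ n ℤ.< profile s v (s ∸ r)) → -[1+ n ] ℤ.< profile s v r
    unmirror h = ℤ.suc[i]≤j⇒i<j (≤-by₁ (subst (ℤ._≤ + n) (profile-mirror r≤s) (ℤ.≮⇒≥ h))
      (solve 2 (λ f n → f :+ :- f := con 1ℤ :+ :- (con 1ℤ :+ n) :+ n) refl (profile s v r) (+ n)))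
    unmirror′ : -[1+ n ] ℤ.< profile s v r → ¬ (+ n ℤ.< profile s v (s ∸ r))
    unmirror′ n< h = 1≰0 (≤-by₂ (ℤ.i<j⇒suc[i]≤j n<)
        (ℤ.i<j⇒suc[i]≤j (subst (+ n ℤ.<_) (profile-mirror r≤s) h))
      (solve 2 (λ f n → con 0ℤ :+ (con 1ℤ :+ :- (con 1ℤ :+ n) :+ (con 1ℤ :+ n)) := con 1ℤ :+
          (f :+ :- f)) refl (profile s v r) (+ n)))

  partition-closed : 0ℤ ℤ.≤ height v k → height v k ℤ.≤ 1ℤ →
    ClosedUnder s partition × ClosedUnder (suc s) partition × ClosedUnder (suc (suc s)) partition
  partition-closed 0≤h h≤1 = levels-closed {f = profile s v} partition-level profile-adjacent
      (profile-mirror z≤n)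
    (subst (0ℤ ℤ.≤_) (sym (profile-low z≤n)) 0≤h) (subst (ℤ._≤ 1ℤ) (sym (profile-low z≤n)) h≤1)

-- The word of a core

record IsLevelFunction (p : List ℕ) (s : ℕ) (f : ℕ → ℤ) : Set where
  field
    level-at : ∀ x → LevelAt p s x (f x)
    adjacent : ∀ x → Adjacent (f x) (f (suc x))
    period   : 1ℤ ℤ.+ f (suc s) ≡ f 0
    mirrored : ∀ {x y} → x + y ≡ s → f y ≡ ℤ.- f x

levelFunction : ∀ {p s} → IsPartition p → SelfConjugate p →
  ClosedUnder s p → ClosedUnder (suc s) p → ClosedUnder (suc (suc s)) p → ∃ (IsLevelFunction p s)
levelFunction ip sc c₀ c₁ c₂ = level ip sc c₁ , record
  { level-at = level-correct ip sc c₁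
  ; adjacent = λ x → level-step-≥ ip sc c₁ c₀ x , level-step-≤ ip sc c₁ c₂ x
  ; period   = level-period ip sc c₁ 0
  ; mirrored = λ {x} {y} → level-mirror ip sc c₁ {x} {y}
  }

-- The two values differ by 2a, an even number of absolute value at most 1.
adjacent-negation⇒0 : ∀ {a} → Adjacent a (ℤ.- a) → a ≡ 0ℤ
adjacent-negation⇒0 {a} (a≤ , -a≤) = ℤ.≤-antisym
  (ℤ.≮⇒≥ λ 0<a → 1≰0 (≤-by₃ a≤ (ℤ.i<j⇒suc[i]≤j 0<a) (ℤ.i<j⇒suc[i]≤j 0<a)
     (solve 1 (λ a → con 0ℤ :+ (a :+ con 1ℤ :+ con 1ℤ) := con 1ℤ :+ (con 1ℤ :- a :+ a :+ a)) refl a)))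
  (ℤ.≮⇒≥ λ a<0 → 1≰0 (≤-by₃ -a≤ (ℤ.i<j⇒suc[i]≤j a<0) (ℤ.i<j⇒suc[i]≤j a<0)
     (solve 1 (λ a → con 0ℤ :+ (:- a :+ (con 1ℤ :+ a) :+ (con 1ℤ :+ a)) := con 1ℤ :+
         (con 1ℤ :+ a :+ con 0ℤ :+ con 0ℤ)) refl a)))

⌊/2⌋-halves : ∀ s → ⌊ s /2⌋ + ⌊ s /2⌋ ≡ s ⊎ ⌊ s /2⌋ + suc ⌊ s /2⌋ ≡ s
⌊/2⌋-halves zero          = inj₁ refl
⌊/2⌋-halves (suc zero)    = inj₂ refl
⌊/2⌋-halves (suc (suc s)) with ⌊/2⌋-halves s
... | inj₁ eq = inj₁ (cong suc (trans (+-suc _ _) (cong suc eq)))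
... | inj₂ eq = inj₂ (cong suc (trans (+-suc _ _) (cong suc eq)))

⌊/2⌋-double-≤ : ∀ s → ⌊ s /2⌋ + ⌊ s /2⌋ ≤ s
⌊/2⌋-double-≤ s = [ ≤-reflexive , (λ eq → ≤-trans (+-monoʳ-≤ ⌊ s /2⌋ (n≤1+n _)) (≤-reflexive eq)) ]′
    (⌊/2⌋-halves s)

bit-⇔ : ∀ {A B : Set} (a? : Dec A) (b? : Dec B) → A ⇔ B → bit a? ≡ bit b?
bit-⇔ (yes _) (yes _) _   = refl
bit-⇔ (yes a) (no ¬b) A⇔B = contradiction (to A⇔B a) ¬b
bit-⇔ (no ¬a) (yes b) A⇔B = contradiction (from A⇔B b) ¬a
bit-⇔ (no _)  (no _)  _   = refl

bit-yes : ∀ {A : Set} (a? : Dec A) → A → bit a? ≡ 1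
bit-yes (yes _) _ = refl
bit-yes (no ¬a) a = contradiction a ¬a

bit-no : ∀ {A : Set} (a? : Dec A) → ¬ A → bit a? ≡ 0
bit-no (yes a) ¬a = contradiction a ¬a
bit-no (no _)  _  = refl

Ascent : (ℕ → ℤ) → ℕ → Set
Ascent f x = 1ℤ ℤ.+ f x ≡ f (suc x)

ascent? : ∀ f → Decidable (Ascent f)
ascent? f x = 1ℤ ℤ.+ f x ℤ.≟ f (suc x)

ascents : (ℕ → ℤ) → ℕ → ℕ
ascents f zero    = 0
ascents f (suc n) = ascents f n + bit (ascent? f n)

length-filter-ascent : ∀ f n → length (filter (ascent? f) (upTo n)) ≡ ascents f n
length-filter-ascent f zero    = refl
length-filter-ascent f (suc n) = trans (length-filter-upTo-suc (ascent? f) n)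
    (cong₂ _+_ (length-filter-ascent f n) single)
  where
  single : length (filter (ascent? f) (n ∷ [])) ≡ bit (ascent? f n)
  single with ascent? f n
  ... | yes _ = refl
  ... | no _  = refl

-- The word traverses `f` from `n` down to 0, so its falls are ascents of `f`. The constant `c` is
-- the starting level `f n`, which lets the induction move along the word.
falls-ascents : ∀ {n} (v : Vec Step n) f c → (∀ i → i ≤ n → height v i ℤ.+ c ≡ f (n ∸ i)) →
    falls v ≡ ascents f n
falls-ascents []              f c eq = refl
falls-ascents {suc n} (σ ∷ v) f c eq = count σ (sym first) (falls-ascents v f (δ σ ℤ.+ c)
    λ i i≤n → trans (solve 3 (λ d h c → h :+ (d :+ c) := d :+ h :+ c) refl (δ σ) (height v i) c)
        (eq (suc i) (s≤s i≤n)))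
  where
  first : δ σ ℤ.+ f (suc n) ≡ f n
  first = trans (cong₂ ℤ._+_ (sym (trans (cong (λ t → δ σ ℤ.+ t) (height-zero v))
      (ℤ.+-identityʳ (δ σ)))) (sym (trans (sym (ℤ.+-identityˡ c)) (eq 0 z≤n))))
    (eq 1 (s≤s z≤n))
  count : ∀ τ → f n ≡ δ τ ℤ.+ f (suc n) → falls v ≡ ascents f n → falls (τ ∷ v) ≡ ascents f n + bit
      (ascent? f n)
  count rise fn rec = trans rec (sym (trans (cong (λ t → ascents f n + t) (bit-no (ascent? f n) λ a →
      2≢0 (≡-by (trans (cong (λ t → 1ℤ ℤ.+ t) (sym fn)) a)
          (solve 1 (λ b → con 0ℤ :+ (con 1ℤ :+ (con 1ℤ :+ b)) := con (+ 2) :+ b) refl (f (suc n))))))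
              (+-identityʳ _)))
    where
    2≢0 : ¬ (+ 2 ≡ 0ℤ)
    2≢0 ()
  count flat fn rec = trans rec (sym (trans (cong (λ t → ascents f n + t) (bit-no (ascent? f n) λ a →
      1≢0 (≡-by (trans (cong (λ t → 1ℤ ℤ.+ t) (sym fn)) a)
          (solve 1 (λ b → con 0ℤ :+ (con 1ℤ :+ (con 0ℤ :+ b)) := con 1ℤ :+ b) refl (f (suc n))))))
              (+-identityʳ _)))
    where
    1≢0 : ¬ (1ℤ ≡ 0ℤ)
    1≢0 ()
  count fall fn rec = trans (cong suc rec)
      (trans (+-comm 1 _) (sym (cong (λ t → ascents f n + t) (bit-yes (ascent? f n)
      (trans (cong (λ t → 1ℤ ℤ.+ t) fn) (solve 1 (λ b → con 1ℤ :+ (con -1ℤ :+ b) := b) refl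
          (f (suc n))))))))

module _ {p s f} (lf : IsLevelFunction p s f) where

  open IsLevelFunction lf

  private
    k : ℕ
    k = ⌊ s /2⌋

    level-end : f s ≡ ℤ.- f 0
    level-end = mirrored refl

  -- The step from s to s + 1 has size 2 f 0 - 1. That it is at least -1 gives this bound; that it
  -- is at most 1 gives the next one.
  level-start-≥0 : 0ℤ ℤ.≤ f 0
  level-start-≥0 = ℤ.≮⇒≥ λ f<0 → 2≰0 (≤-by₃ (subst₂ ℤ._≤_ level-end period (proj₁ (adjacent s)))
      (ℤ.i<j⇒suc[i]≤j f<0) (ℤ.i<j⇒suc[i]≤j f<0)
    (solve 1 (λ a → con 0ℤ :+ (:- a :+ (con 1ℤ :+ a) :+ (con 1ℤ :+ a)) := con (+ 2) :+
        (a :+ con 0ℤ :+ con 0ℤ)) refl (f 0)))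
    where
    2≰0 : ¬ (+ 2 ℤ.≤ 0ℤ)
    2≰0 (+≤+ ())

  level-start-≤1 : f 0 ℤ.≤ 1ℤ
  level-start-≤1 = ℤ.≮⇒≥ λ 1<f → 2≰0 (≤-by₃
      (subst (λ t → f (suc s) ℤ.≤ 1ℤ ℤ.+ t) level-end (proj₂ (adjacent s)))
    (ℤ.i<j⇒suc[i]≤j 1<f) (ℤ.≤-trans (ℤ.i<j⇒suc[i]≤j 1<f) (ℤ.≤-reflexive (sym period)))
    (solve 2 (λ a b → con 0ℤ :+ (b :+ con (+ 2) :+ con (+ 2)) := con (+ 2) :+
        (con 1ℤ :- a :+ a :+ (con 1ℤ :+ b))) refl (f 0) (f (suc s))))
    where
    2≰0 : ¬ (+ 2 ℤ.≤ 0ℤ)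
    2≰0 (+≤+ ())

  -- For even s the point k is its own reflection; for odd s it is reflected to its neighbour k + 1.
  -- Either way the level is adjacent to its negative.
  level-middle : f k ≡ 0ℤ
  level-middle with ⌊/2⌋-halves s
  ... | inj₁ eq = adjacent-negation⇒0 (subst (Adjacent (f k)) (mirrored eq) adjacent-refl)
  ... | inj₂ eq = adjacent-negation⇒0 (subst (Adjacent (f k)) (mirrored eq) (adjacent k))

  word-exists : ∃ λ (v : Vec Step k) → ∀ i → i ≤ k → height v i ≡ f (k ∸ i)
  word-exists = height-realises k (λ i → f (k ∸ i)) level-middle λ i i<k →
    subst (λ t → StepBetween (f t) (f (k ∸ suc i))) (sym (+-∸-assoc 1 i<k))
      (stepBetween (proj₁ (adjacent (k ∸ suc i))) (proj₂ (adjacent (k ∸ suc i))))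

  word : Vec Step k
  word = proj₁ word-exists

  word-height : ∀ i → i ≤ k → height word i ≡ f (k ∸ i)
  word-height = proj₂ word-exists

  word-profile : ∀ r → r ≤ s → profile s word r ≡ f r
  word-profile r r≤s with r ≤? k
  ... | yes r≤k = trans (profile-low (⌊/2⌋-double-≤ s) word r≤k)
      (trans (word-height (k ∸ r) (m∸n≤m k r)) (cong f (m∸[m∸n]≡n r≤k)))
  ... | no r≰k = trans (profile-high (⌊/2⌋-double-≤ s) word (<⇒≤ (≰⇒> r≰k))) (trans
      (cong ℤ.-_ (trans (word-height (k ∸ (s ∸ r)) (m∸n≤m k (s ∸ r))) (cong f (m∸[m∸n]≡n s∸r≤k))))
      (sym (mirrored (m∸n+n≡m r≤s))))
    where
    s∸r≤k : s ∸ r ≤ k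
    s∸r≤k = m≤n+o⇒m∸n≤o s r (≤-trans (≤-trans
        ([ (λ eq → ≤-trans (≤-reflexive (sym eq)) (+-monoʳ-≤ k (n≤1+n k))) ,
            (λ eq → ≤-reflexive (sym eq)) ]′ (⌊/2⌋-halves s))
      (≤-reflexive (+-suc k k))) (+-monoˡ-≤ k (≰⇒> r≰k)))

  word-partition : IsPartition p → partition (⌊/2⌋-double-≤ s) word ≡ p
  word-partition ip = levels-determine {f = f} (partition-isPartition (⌊/2⌋-double-≤ s) word) ip
    (λ r r≤s → subst (LevelAt _ s r) (word-profile r r≤s) (partition-level (⌊/2⌋-double-≤ s) word r r≤s))
    (λ r _ → level-at r)

  private
    -- Reflection reverses both the direction of a step and the sign of the levels.
    ascent-mirror : ∀ {x y} → suc (x + y) ≡ s → Ascent f x → Ascent f y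
    ascent-mirror {x} {y} eq a = begin
      1ℤ ℤ.+ f y                ≡⟨ cong (λ t → 1ℤ ℤ.+ t) (mirrored eq) ⟩
      1ℤ ℤ.- f (suc x)          ≡⟨ ≡-by a (solve 2
          (λ b c → :- b :+ (con 1ℤ :+ b) := con 1ℤ :- c :+ c) refl (f x) (f (suc x))) ⟩
      ℤ.- f x                   ≡⟨ mirrored (trans (+-suc x y) eq) ⟨
      f (suc y)                 ∎
      where open ≡-Reasoning

  -- The last `j` steps before s are the reflections of the first `j`.
  ascents-mirror : ∀ j → j ≤ s → ascents f (s ∸ j) + ascents f j ≡ ascents f s
  ascents-mirror zero    _   = +-identityʳ _
  ascents-mirror (suc j) j<s = trans (sym (trans (cong (λ t → ascents f t + ascents f j) (+-∸-assoc 1 j<s))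
      (trans (cong (λ t → ascents f (s ∸ suc j) + t + ascents f j)
          (bit-⇔ (ascent? f (s ∸ suc j)) (ascent? f j)
          (mk⇔ (ascent-mirror (trans (sym (+-suc _ j)) (m∸n+n≡m j<s)))
              (ascent-mirror (trans (cong suc (+-comm j _)) (trans (sym (+-suc _ j)) (m∸n+n≡m j<s)))))))
        (regroup (ascents f (s ∸ suc j)) (bit (ascent? f j)) (ascents f j)))))
      (ascents-mirror j (<⇒≤ j<s))
    where
    regroup : ∀ a b c → a + b + c ≡ a + (c + b)
    regroup = solve-∀

-- Corners as ascents of the level function

lookup-injective : ∀ {A : Set} {xs : List A} → Unique xs → ∀ i j → lookup xs i ≡ lookup xs j → i ≡ j
lookup-injective (_ ∷ _)   zero    zero    _  = refl
lookup-injective (x∉ ∷ _)  zero    (suc j) eq = contradiction eq (All.lookup x∉ (∈-lookup j))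
lookup-injective (x∉ ∷ _)  (suc i) zero    eq = contradiction (sym eq) (All.lookup x∉ (∈-lookup i))
lookup-injective (_ ∷ xs!) (suc i) (suc j) eq = cong suc (lookup-injective xs! i j eq)

-- The pigeonhole principle for a relation rather than a function: `Corner`, read in both
-- directions, then gives both inequalities between corners and ascents.
length-≤-by : ∀ {A B : Set} (R : A → B → Set) {xs ys} → Unique xs →
  (∀ {x} → x ∈ xs → ∃ λ y → y ∈ ys × R x y) → (∀ {x x′ y} → R x y → R x′ y → x ≡ x′) → length xs ≤ length ys
length-≤-by R {xs} {ys} xs! total inj = Fin.injective⇒≤ {f = position} λ {i} {j} eq →
    lookup-injective xs! i j
  (inj (related i) (subst (R (lookup xs j))
    (trans (lookup-index (target j)) (trans (cong (lookup ys) (sym eq))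
        (sym (lookup-index (target i))))) (related j)))
  where
  image : ∀ i → ∃ λ y → y ∈ ys × R (lookup xs i) y
  image i = total (∈-lookup i)
  target : ∀ i → proj₁ (image i) ∈ ys
  target i = proj₁ (proj₂ (image i))
  related : ∀ i → R (lookup xs i) (proj₁ (image i))
  related i = proj₂ (proj₂ (image i))
  position : Fin (length xs) → Fin (length ys)
  position i = index (target i)

residue-separated : ∀ {s r r′ q q′} → r ≤ s → q ℤ.< q′ → + r ℤ.+ q ℤ.* + suc s ≢ + r′ ℤ.+ q′ ℤ.* + suc s
residue-separated {s} {r} {r′} {q} {q′} r≤s q<q′ eq = 1≰0 (≤-by₃
  (ℤ.*-monoʳ-≤-nonNeg (+ suc s) (ℤ.i<j⇒suc[i]≤j q<q′)) (+≤+ (≤-trans r≤s (m≤m+n s r′)))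
      (ℤ.≤-reflexive (sym eq))
  (solve 5 (λ r r′ q q′ s → con 0ℤ :+ ((con 1ℤ :+ q) :* (con 1ℤ :+ s) :+ r :+
      (r′ :+ q′ :* (con 1ℤ :+ s))) :=
                            con 1ℤ :+ (q′ :* (con 1ℤ :+ s) :+ (s :+ r′) :+ (r :+ q :* (con 1ℤ :+ s))))
                                refl (+ r) (+ r′) q q′ (+ s)))

residue-unique : ∀ {s r r′ q q′} → r ≤ s → r′ ≤ s → + r ℤ.+ q ℤ.* + suc s ≡ + r′ ℤ.+ q′ ℤ.* + suc s → r ≡ r′
residue-unique {s} {r} {r′} {q} {q′} r≤s r′≤s eq with ℤ.<-cmp q q′
... | tri< q<q′ _ _ = contradiction eq (residue-separated {r′ = r′} r≤s q<q′)
... | tri> _ _ q′<q = contradiction (sym eq) (residue-separated {r′ = r} r′≤s q′<q)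
... | tri≈ _ refl _ = ℤ.+-injective (≡-by eq
    (solve 3 (λ a b c → b :+ (a :+ c) := a :+ (b :+ c)) refl (+ r) (+ r′) (q ℤ.* + suc s)))

-- An ascent at x, translated by f x periods, becomes an ascent of the level
-- function from 0 to 1: a bead whose predecessor is not a bead. Such beads are
-- the last rows of a given length.
record Corner (p : List ℕ) (s : ℕ) (f : ℕ → ℤ) (x v : ℕ) : Set where
  field
    residue-≤ : x ≤ s
    last-row  : ℕ
    part≡     : part p last-row ≡ v
    part-next : part p (suc last-row) < v
    position  : + suc x ℤ.+ f x ℤ.* + suc s ℤ.+ + suc last-row ≡ + v

module _ {p s f} (ip : IsPartition p) (lf : IsLevelFunction p s f) where

  open IsLevelFunction lf

  private
    l = proj₁ ip

  -- With q = f x, the number x + 1 + q (s + 1) is a bead and its predecessor is not. If the next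
  -- row had the same length, its bead would be that predecessor.
  ascent⇒corner : ∀ {x} → x ≤ s → Ascent f x → ∃ λ v → v ∈ p × Corner p s f x v
  ascent⇒corner {x} x≤s a with from (level-at (suc x) (f x)) (ℤ.suc[i]≤j⇒i<j (ℤ.≤-reflexive a))
  ... | bead i eq = part p i , part∈ p i (≤-<-trans z≤n shorter) , record
      { residue-≤ = x≤s ; last-row = i ; part≡ = refl ; part-next = shorter ; position = eq }
    where
    shorter : part p (suc i) < part p i
    shorter = ≤∧≢⇒< (part-step l i) λ same → ℤ.<-irrefl refl (to (level-at x (f x)) (bead (suc i)
      (trans (solve 3 (λ x y i → x :+ y :+ (con (+ 2) :+ i) := con 1ℤ :+ x :+ y :+ (con 1ℤ :+ i)) refl
          (+ x) (f x ℤ.* + suc s) (+ i))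
             (trans eq (cong +_ (sym same))))))

  -- The number z just below the bead of the last row of length `v` is not a bead: rows up to that
  -- one have larger beads, later rows smaller ones. Writing z as r + q (s + 1) gives f r ≤ q < f (r
  -- + 1), and adjacency leaves only f r = q.
  part⇒corner : ∀ {v} → v ∈ p → ∃ λ x → Ascent f x × Corner p s f x v
  part⇒corner {v} v∈p with ∈⇒last-part ip v∈p
  ... | i , refl , shorter with residue s (+ part p i ℤ.- + suc (suc i))
  ...   | r , q , r≤s , eq = r , ascent , record
      { residue-≤ = r≤s ; last-row = i ; part≡ = refl ; part-next = shorter
      ; position = subst (λ t → + suc r ℤ.+ t ℤ.* + suc s ℤ.+ + suc i ≡ + part p i) (sym fr≡q) at-row′ }
    where
    z : ℤ
    z = + r ℤ.+ q ℤ.* + suc s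
    at-row : 1ℤ ℤ.+ z ℤ.+ + suc i ≡ + part p i
    at-row = ≡-by (sym eq) (solve 4 (λ r y i a → a :+ (r :+ y) := con 1ℤ :+ (r :+ y) :+ (con 1ℤ :+ i) :+
        (a :- (con (+ 2) :+ i))) refl (+ r) (q ℤ.* + suc s) (+ i) (+ part p i))
    at-row′ : + suc r ℤ.+ q ℤ.* + suc s ℤ.+ + suc i ≡ + part p i
    at-row′ = trans (cong (λ t → t ℤ.+ + suc i) (ℤ.+-assoc 1ℤ (+ r) (q ℤ.* + suc s))) at-row
    no-bead : ¬ Bead p z
    no-bead (bead j eqj) with j ≤? i
    ... | yes j≤i = 1≰0 (≤-by₃
          (ℤ.+-mono-≤ (+≤+ (part-antitone l j≤i)) (ℤ.≤-reflexive at-row)) (ℤ.≤-reflexive (sym eqj))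
              (+≤+ j≤i)
          (solve 5 (λ z i j a b → con 0ℤ :+ (a :+ (con 1ℤ :+ z :+ (con 1ℤ :+ i)) :+ b :+ j) := con 1ℤ :+
              (b :+ a :+ (z :+ (con 1ℤ :+ j)) :+ i)) refl
            z (+ i) (+ j) (+ part p i) (+ part p j)))
    ... | no j≰i = 1≰0 (≤-by₃
          (ℤ.+-mono-≤ (+≤+ (≤-<-trans (part-antitone l (≰⇒> j≰i)) shorter))
              (ℤ.≤-reflexive (sym at-row))) (ℤ.≤-reflexive eqj) (+≤+ (≰⇒> j≰i))
          (solve 5 (λ z i j a b → con 0ℤ :+ (con 1ℤ :+ b :+ a :+ (z :+ (con 1ℤ :+ j)) :+
              (con 1ℤ :+ i)) := con 1ℤ :+ (a :+ (con 1ℤ :+ z :+ (con 1ℤ :+ i)) :+ b :+ j)) refl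
            z (+ i) (+ j) (+ part p i) (+ part p j)))
    fr≤q : f r ℤ.≤ q
    fr≤q = ℤ.≮⇒≥ λ q<f → no-bead (from (level-at r q) q<f)
    q<f : q ℤ.< f (suc r)
    q<f = to (level-at (suc r) q) (bead i at-row′)
    fr≡q : f r ≡ q
    fr≡q = ℤ.≤-antisym fr≤q (≤-by₂ (ℤ.i<j⇒suc[i]≤j q<f) (proj₂ (adjacent r))
      (solve 3 (λ a b q → a :+ (con 1ℤ :+ q :+ b) := q :+ (b :+ (con 1ℤ :+ a))) refl (f r) (f (suc r)) q))
    ascent : Ascent f r
    ascent = ℤ.≤-antisym (subst (λ t → 1ℤ ℤ.+ t ℤ.≤ f (suc r)) (sym fr≡q) (ℤ.i<j⇒suc[i]≤j q<f))
        (proj₂ (adjacent r))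

  corner-functional : ∀ {x v w} → Corner p s f x v → Corner p s f x w → v ≡ w
  corner-functional {x} c d = trans (sym C.part≡)
      (trans (cong (part p) (bead-index l (bead-at c) (bead-at d))) D.part≡)
    where
    module C = Corner c
    module D = Corner d
    bead-at : ∀ {v} (c : Corner p s f x v) → Bead p (+ suc x ℤ.+ f x ℤ.* + suc s)
    bead-at c = bead (Corner.last-row c) (trans (Corner.position c) (cong +_ (sym (Corner.part≡ c))))

  -- A part size has one last row, hence one bead, and the residue of its predecessor is the
  -- position of the ascent.
  corner-injective : ∀ {x y v} → Corner p s f x v → Corner p s f y v → x ≡ y
  corner-injective {x} {y} {v} c d = residue-unique {q = f x} {f y} C.residue-≤ D.residue-≤ (≡-by
      (trans C.position (trans (sym D.position)
          (cong (λ i → + suc y ℤ.+ f y ℤ.* + suc s ℤ.+ + suc i) (sym same-row))))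
      (solve 5 (λ x y a b i → y :+ b :+ (con 1ℤ :+ x :+ a :+ i) := x :+ a :+ (con 1ℤ :+ y :+ b :+ i)) refl
        (+ x) (+ y) (f x ℤ.* + suc s) (f y ℤ.* + suc s) (+ suc C.last-row)))
    where
    module C = Corner c
    module D = Corner d
    not-later : ∀ {i j} → part p (suc i) < v → part p j ≡ v → ¬ (i < j)
    not-later next eq i<j = <-irrefl eq (≤-<-trans (part-antitone l i<j) next)
    same-row : C.last-row ≡ D.last-row
    same-row = ≤-antisym (≮⇒≥ (not-later D.part-next C.part≡)) (≮⇒≥ (not-later C.part-next D.part≡))

  corners-ascents : corners p ≡ ascents f (suc s)
  corners-ascents = trans (≤-antisym
    (length-≤-by (λ v x → Corner p s f x v) (DecUnique.deduplicate-! _≟_ p) part-total corner-functional)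
    (length-≤-by (Corner p s f) (Unique.filter⁺ (ascent? f)
        (Unique.upTo⁺ (suc s))) ascent-total corner-injective))
    (length-filter-ascent f (suc s))
    where
    ascent-total : ∀ {x} → x ∈ filter (ascent? f) (upTo (suc s)) → ∃ λ v →
        v ∈ deduplicate _≟_ p × Corner p s f x v
    ascent-total x∈ with ∈-filter⁻ (ascent? f) {xs = upTo (suc s)} x∈
    ... | x∈upTo , a with ascent⇒corner (s≤s⁻¹ (∈-upTo⁻ x∈upTo)) a
    ...   | v , v∈p , c = v , ∈-deduplicate⁺ _≟_ v∈p , c
    part-total : ∀ {v} → v ∈ deduplicate _≟_ p → ∃ λ x → x ∈ filter (ascent? f)
        (upTo (suc s)) × Corner p s f x v
    part-total v∈ with part⇒corner (∈-deduplicate⁻ _≟_ p v∈)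
    ... | x , a , c = x , ∈-filter⁺ (ascent? f) (∈-upTo⁺ (s≤s (Corner.residue-≤ c))) a , c

0≤i≤1 : ∀ {i} → 0ℤ ℤ.≤ i → i ℤ.≤ 1ℤ → i ≡ 0ℤ ⊎ i ≡ 1ℤ
0≤i≤1 {+ 0}            _ _ = inj₁ refl
0≤i≤1 {+ 1}            _ _ = inj₂ refl
0≤i≤1 {+ suc (suc n)}  _ (+≤+ (s≤s ()))

module _ {p s f} (lf : IsLevelFunction p s f)
         (v : Vec Step ⌊ s /2⌋) (v-height : ∀ i → i ≤ ⌊ s /2⌋ → height v i ≡ f (⌊ s /2⌋ ∸ i)) where

  open IsLevelFunction lf

  private
    k : ℕ
    k = ⌊ s /2⌋

    height-last : height v k ≡ f 0
    height-last = trans (v-height k ≤-refl) (cong f (n∸n≡0 k))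

  rises-falls : (f 0 ≡ 0ℤ × rises v ≡ falls v) ⊎ (f 0 ≡ 1ℤ × rises v ≡ suc (falls v))
  rises-falls with 0≤i≤1 (level-start-≥0 lf) (level-start-≤1 lf)
  ... | inj₁ f0 = inj₁ (f0 , ℤ.+-injective (≡-by (trans (sym (height-end v)) (trans height-last f0))
        (solve 2 (λ a b → b :+ (a :- b) := a :+ con 0ℤ) refl (+ rises v) (+ falls v))))
  ... | inj₂ f0 = inj₂ (f0 , ℤ.+-injective (≡-by (trans (sym (height-end v)) (trans height-last f0))
        (solve 2 (λ a b → con 1ℤ :+ b :+ (a :- b) := a :+ con 1ℤ) refl (+ rises v) (+ falls v))))

  private
    ascents-half : ascents f k ≡ falls v
    ascents-half = sym (falls-ascents v f 0ℤ λ i i≤k → trans (ℤ.+-identityʳ _) (v-height i i≤k))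

    -- Reflection doubles the ascents of the first half. For odd s there is one more step, from k to
    -- k + 1, and it is flat because both ends have level 0.
    ascents-below : ascents f s ≡ falls v + falls v
    ascents-below with ⌊/2⌋-halves s
    ... | inj₁ eq = trans (sym (ascents-mirror lf k (m+n≤o⇒m≤o k (≤-reflexive eq)))) (cong₂ _+_
          (trans (cong (ascents f) (trans (cong (_∸ k) (sym eq)) (m+n∸n≡m k k))) ascents-half) ascents-half)
    ... | inj₂ eq = trans (sym (ascents-mirror lf k (m+n≤o⇒m≤o k (≤-reflexive eq)))) (cong₂ _+_
          (trans (cong (ascents f) (trans (cong (_∸ k) (sym eq)) (m+n∸m≡n k (suc k))))
            (trans (cong (λ t → ascents f k + t) (bit-no (ascent? f k) flat-middle))
                (trans (+-identityʳ _) ascents-half))) ascents-half)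
      where
      flat-middle : ¬ Ascent f k
      flat-middle a with trans (sym (cong (λ t → 1ℤ ℤ.+ t) (level-middle lf)))
          (trans a (trans (mirrored eq) (cong ℤ.-_ (level-middle lf))))
      ... | ()

    level-last : ∀ {i} → f 0 ≡ i → f s ≡ ℤ.- i
    level-last f0 = trans (mirrored refl) (cong ℤ.-_ f0)

  -- The closing step from s to s + 1 is an ascent exactly when f 0 = 1, that is, when the word has
  -- one more rise than falls.
  ascents-total : ascents f (suc s) ≡ rises v + falls v
  ascents-total with rises-falls
  ... | inj₁ (f0 , r) = trans (cong₂ _+_ ascents-below (bit-no (ascent? f s) no-ascent))
        (trans (+-identityʳ _) (cong (_+ falls v) (sym r)))
    where
    no-ascent : ¬ Ascent f s
    no-ascent a with trans (sym (cong (λ t → 1ℤ ℤ.+ (1ℤ ℤ.+ t)) (level-last f0)))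
        (trans (cong (λ t → 1ℤ ℤ.+ t) a) (trans period f0))
    ... | ()
  ... | inj₂ (f0 , r) = trans (cong₂ _+_ ascents-below (bit-yes (ascent? f s) last-ascent))
        (trans (+-comm _ 1) (cong (_+ falls v) (sym r)))
    where
    last-ascent : Ascent f s
    last-ascent = trans (cong (λ t → 1ℤ ℤ.+ t) (level-last f0))
      (≡-by (sym (trans period f0)) (solve 1 (λ b → b :+ con 1ℤ := con 0ℤ :+ (con 1ℤ :+ b)) refl
          (f (suc s))))

cores⇔closed : ∀ {p s} → IsPartition p → SelfConjugate p →
  AreCores (s ∷ s + 1 ∷ s + 2 ∷ []) p ⇔
      (ClosedUnder s p × ClosedUnder (suc s) p × ClosedUnder (suc (suc s)) p)
cores⇔closed {p} {s} ip sc = mk⇔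
  (λ { (c₀ ∷ c₁ ∷ c₂ ∷ []) → to (closed s) c₀
     , to (closed (suc s)) (subst (λ t → IsCore t p) (+-comm s 1) c₁)
     , to (closed (2 + s)) (subst (λ t → IsCore t p) (+-comm s 2) c₂) })
  (λ (c₀ , c₁ , c₂) → from (closed s) c₀
     ∷ subst (λ t → IsCore t p) (+-comm 1 s) (from (closed (suc s)) c₁)
     ∷ subst (λ t → IsCore t p) (+-comm 2 s) (from (closed (2 + s)) c₂) ∷ [])
  where
  closed : ∀ t → IsCore t p ⇔ ClosedUnder t p
  closed t = core⇔bead ip sc {t}

-- The bijection between words and cores

module _ {s : ℕ} where

  private
    k : ℕ
    k = ⌊ s /2⌋

    2k≤s : k + k ≤ s
    2k≤s = ⌊/2⌋-double-≤ s

  partition-injective : ∀ {v w} → partition 2k≤s v ≡ partition 2k≤s w → v ≡ w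
  partition-injective {v} {w} eq = height-injective v w λ i i≤k → begin
    height v i               ≡⟨ cong (height v) (m∸[m∸n]≡n i≤k) ⟨
    height v (k ∸ (k ∸ i))   ≡⟨ profile-low 2k≤s v (m∸n≤m k i) ⟨
    profile s v (k ∸ i)      ≡⟨ level-unique (partition-level 2k≤s v (k ∸ i) (low i))
                                  (subst (λ p → LevelAt p s (k ∸ i) (profile s w (k ∸ i))) (sym eq)
                                      (partition-level 2k≤s w (k ∸ i) (low i))) ⟩
    profile s w (k ∸ i)      ≡⟨ profile-low 2k≤s w (m∸n≤m k i) ⟩
    height w (k ∸ (k ∸ i))   ≡⟨ cong (height w) (m∸[m∸n]≡n i≤k) ⟩
    height w i               ∎
    where
    open ≡-Reasoning
    low : ∀ i → k ∸ i ≤ s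
    low i = ≤-trans (m∸n≤m k i) (m+n≤o⇒m≤o k 2k≤s)

  -- The level function found by search and the prescribed `profile` are identified on 0 to k by
  -- uniqueness of levels, so `v` is the word of the partition built from it.
  partition-corners : ∀ v → 0ℤ ℤ.≤ height v k → height v k ℤ.≤ 1ℤ → corners
      (partition 2k≤s v) ≡ rises v + falls v
  partition-corners v 0≤h h≤1 = trans (corners-ascents ip lf) (ascents-total lf v v-height)
    where
    ip = partition-isPartition 2k≤s v
    sc = partition-selfConjugate 2k≤s v
    closed = partition-closed 2k≤s v 0≤h h≤1
    level-f = levelFunction ip sc (proj₁ closed) (proj₁ (proj₂ closed)) (proj₂ (proj₂ closed))
    lf = proj₂ level-f
    v-height : ∀ i → i ≤ k → height v i ≡ proj₁ level-f (k ∸ i)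
    v-height i i≤k = trans (cong (height v) (sym (m∸[m∸n]≡n i≤k)))
        (trans (sym (profile-low 2k≤s v (m∸n≤m k i)))
      (level-unique (partition-level 2k≤s v (k ∸ i) (≤-trans (m∸n≤m k i) (m+n≤o⇒m≤o k 2k≤s)))
          (IsLevelFunction.level-at lf (k ∸ i))))

  core-word : ∀ {p} → IsPartition p → SelfConjugate p → AreCores (s ∷ s + 1 ∷ s + 2 ∷ []) p →
    ∃ λ v → partition 2k≤s v ≡ p × corners p ≡ rises v + falls v ×
        (rises v ≡ falls v ⊎ rises v ≡ suc (falls v))
  core-word ip sc cores = v , word-partition lf ip , trans (corners-ascents ip lf)
      (ascents-total lf v (word-height lf)) ,
    [ (λ (_ , r) → inj₁ r) , (λ (_ , r) → inj₂ r) ]′ (rises-falls lf v (word-height lf))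
    where
    closed = to (cores⇔closed ip sc) cores
    lf = proj₂ (levelFunction ip sc (proj₁ closed) (proj₁ (proj₂ closed)) (proj₂ (proj₂ closed)))
    v = word lf

⌊m+1/2⌋-cases : ∀ m → ⌊ m + 1 /2⌋ ≡ ⌊ m /2⌋ ⊎ ⌊ m + 1 /2⌋ ≡ suc ⌊ m /2⌋
⌊m+1/2⌋-cases zero          = inj₁ refl
⌊m+1/2⌋-cases (suc zero)    = inj₂ refl
⌊m+1/2⌋-cases (suc (suc m)) = [ (λ eq → inj₁ (cong suc eq)) , (λ eq → inj₂ (cong suc eq)) ]′
    (⌊m+1/2⌋-cases m)

⌊m/2⌋+⌊m+1/2⌋ : ∀ m → ⌊ m /2⌋ + ⌊ m + 1 /2⌋ ≡ m
⌊m/2⌋+⌊m+1/2⌋ m = trans (cong (λ t → ⌊ m /2⌋ + ⌊ t /2⌋) (+-comm m 1)) (⌊n/2⌋+⌈n/2⌉≡n m)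

-- Two numbers whose difference is 0 or 1 can be read off from their sum; thus the number of corners
-- fixes the numbers of falls and rises.
near-halves : ∀ a b → b ≡ a ⊎ b ≡ suc a → a ≡ ⌊ b + a /2⌋ × b ≡ ⌊ b + a + 1 /2⌋
near-halves a .a       (inj₁ refl) = n≡⌊n+n/2⌋ a , trans (n≡⌈n+n/2⌉ a) (cong ⌊_/2⌋ (+-comm 1 (a + a)))
near-halves a .(suc a) (inj₂ refl) = n≡⌈n+n/2⌉ a , trans (cong suc (n≡⌊n+n/2⌋ a))
    (cong (λ t → ⌊ suc t /2⌋) (+-comm 1 (a + a)))

module _ (s m : ℕ) where

  private
    k a b : ℕ
    k = ⌊ s /2⌋
    a = ⌊ m /2⌋
    b = ⌊ m + 1 /2⌋

    2k≤s : k + k ≤ s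
    2k≤s = ⌊/2⌋-double-≤ s

  IsCounted : List ℕ → Set
  IsCounted p = IsPartition p × SelfConjugate p × AreCores (s ∷ s + 1 ∷ s + 2 ∷ []) p × corners p ≡ m

  word⇒counted : ∀ {v} → v ∈ words k b a → IsCounted (partition 2k≤s v)
  word⇒counted {v} v∈ = ip , sc , from (cores⇔closed ip sc) (partition-closed 2k≤s v 0≤h h≤1) ,
    trans (partition-corners v 0≤h h≤1) (trans (cong₂ _+_ (proj₁ counts) (proj₂ counts))
        (trans (+-comm b a) (⌊m/2⌋+⌊m+1/2⌋ m)))
    where
    counts : rises v ≡ b × falls v ≡ a
    counts = ∈-words⁻ k v∈
    ip : IsPartition (partition 2k≤s v)
    ip = partition-isPartition 2k≤s v
    sc : SelfConjugate (partition 2k≤s v)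
    sc = partition-selfConjugate 2k≤s v
    end : height v k ≡ + b ℤ.- + a
    end = trans (height-end v) (cong₂ (λ r d → + r ℤ.- + d) (proj₁ counts) (proj₂ counts))
    end-cases : height v k ≡ 0ℤ ⊎ height v k ≡ 1ℤ
    end-cases = [ (λ eq → inj₁ (trans end (trans (cong (λ t → + t ℤ.- + a) eq) (ℤ.+-inverseʳ (+ a)))))
                , (λ eq → inj₂ (trans end (trans (cong (λ t → + t ℤ.- + a) eq)
                    (solve 1 (λ a → con 1ℤ :+ a :- a := con 1ℤ) refl (+ a))))) ]′ (⌊m+1/2⌋-cases m)
    0≤h : 0ℤ ℤ.≤ height v k
    0≤h = [ (λ eq → ℤ.≤-reflexive (sym eq)) , (λ eq → subst (0ℤ ℤ.≤_) (sym eq) (+≤+ z≤n)) ]′ end-cases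
    h≤1 : height v k ℤ.≤ 1ℤ
    h≤1 = [ (λ eq → subst (ℤ._≤ 1ℤ) (sym eq) (+≤+ z≤n)) , ℤ.≤-reflexive ]′ end-cases

  counted⇒word : ∀ {p} → IsCounted p → ∃ λ v → v ∈ words k b a × p ≡ partition 2k≤s v
  counted⇒word {p} (ip , sc , cores , corners≡m) = v , subst₂ (λ b a → v ∈ words k b a)
      (trans (proj₂ halves) (cong (λ t → ⌊ t + 1 /2⌋) size)) (trans (proj₁ halves) (cong ⌊_/2⌋ size))
          (∈-words⁺ v) ,
      sym (proj₁ (proj₂ found))
    where
    found : ∃ λ v → partition 2k≤s v ≡ p × corners p ≡ rises v + falls v ×
        (rises v ≡ falls v ⊎ rises v ≡ suc (falls v))
    found = core-word ip sc cores
    v : Vec Step k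
    v = proj₁ found
    halves : falls v ≡ ⌊ rises v + falls v /2⌋ × rises v ≡ ⌊ rises v + falls v + 1 /2⌋
    halves = near-halves (falls v) (rises v) (proj₂ (proj₂ (proj₂ found)))
    size : rises v + falls v ≡ m
    size = trans (sym (proj₁ (proj₂ (proj₂ found)))) corners≡m

proposition3p9 : (s m : ℕ) → s > 0 →
    HasCardinality
    (λ p → IsPartition p
    × SelfConjugate p
    × AreCores (s ∷ s + 1 ∷ s + 2 ∷ []) p
    × corners p ≡ m)
    (multinomial ⌊ s /2⌋ (+ ⌊ m /2⌋) (+ ⌊ m + 1 /2⌋) (+ ⌊ s /2⌋ - + m))
proposition3p9 s m s>0 =
  map (partition (⌊/2⌋-double-≤ s)) ws ,
  Unique.map⁺ partition-injective (words-unique ⌊ s /2⌋ ⌊ m + 1 /2⌋ ⌊ m /2⌋) ,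
  (λ p → mk⇔
    (λ p∈ → let v , v∈ , p≡ = ∈-map⁻ (partition (⌊/2⌋-double-≤ s)) p∈ in subst (IsCounted s m) (sym p≡) (word⇒counted s m v∈))
    (λ counted → let v , v∈ , p≡ = counted⇒word s m counted in
       subst (_∈ map (partition (⌊/2⌋-double-≤ s)) ws) (sym p≡)
           (∈-map⁺ (partition (⌊/2⌋-double-≤ s)) v∈))) ,
  trans (length-map (partition (⌊/2⌋-double-≤ s)) ws)
      (wordCount-multinomial ⌊ s /2⌋ m ⌊ m /2⌋ ⌊ m + 1 /2⌋ (⌊m/2⌋+⌊m+1/2⌋ m))
  where
  ws : List (Vec Step ⌊ s /2⌋)
  ws = words ⌊ s /2⌋ ⌊ m + 1 /2⌋ ⌊ m /2⌋
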